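{- Let $K$ be a field and let $(\mu(k))_{k\ge 0}$ be a sequence of elements of $K$ with $\mu(0)=1$ such that none of the Hankel determinants $H_k=\det(\mu(i+j))_{i,j=0}^{k-1}$, $k\ge 0$, vanishes. Let $p(k,j)$ be the signed coefficients of the associated monic orthogonal polynomials $p_k(x)=\sum_{j=0}^k(-1)^{k-j}p(k,j)x^j$, with $p(k,j)=0$ for $j>k$. Then for all integers $m\ge 0$ and $n\ge 1$, \[ \det(\mu(i+j))_{i,j=0}^{m-1}\cdot \det(p(i+m,j))_{i,j=0}^{n-1}=\det(\mu(i+j+n))_{i,j=0}^{m-1}. \]
   Context: The determinant of an empty ($0\times 0$) matrix is $1$; in particular $H_0=1$. For a sequence $(\mu(k))_{k\ge0}$ with all $H_k\neq 0$, and for each $k\ge 0$, the polynomial $p_k(x)$ and the coefficients $p(k,j)$, $0\le j\le k$, are defined by \[ p_k(x)=\sum_{j=0}^k(-1)^{k-j}p(k,j)\,x^j=\frac{1}{H_k}\det\begin{pmatrix} \mu(0) & \mu(1) & \cdots & \mu(k) \\ \mu(1) & \mu(2) & \cdots & \mu(k+1) \\ \vdots & \vdots & \ddots & \vdots \\ \mu(k-1) & \mu(k) & \cdots & \mu(2k-1) \\ 1 & x & \cdots & x^k \end{pmatrix}, \] a $(k+1)\times(k+1)$ determinant (so $p_0(x)=1$). Set $p(k,j)=0$ for $j>k$. These polynomials are orthogonal with respect to the linear functional sending $x^k$ to $\mu(k)$. -}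

module Defs where

open import Algebra.Bundles using (RawRing; module CommutativeRing)
open import Algebra.Apartness.Bundles using (HeytingField; module HeytingCommutativeRing)
import Algebra.Definitions.RawSemiring as RawSemiringOps
open import Data.Bool.Base using (if_then_else_)
open import Data.Fin.Base using (Fin; zero; suc; toℕ; punchIn)
open import Data.List.Base using (List; []; _∷_; map)
open import Data.Nat.Base as ℕ using (ℕ; zero; suc; _∸_; _≤ᵇ_; _<ᵇ_)
open import Data.Product.Base using (proj₁)
open import Level using (Level)

private
  variable
    a c ℓ ℓ₁ ℓ₂ : Level

Matrix : Set a → ℕ → Set a
Matrix A n = Fin n → Fin n → A

module Determinant (R : RawRing c ℓ) where
  open RawRing R
  open RawSemiringOps rawSemiring using (_^_; sum)

  -- Laplace expansion along the first row.
  det : ∀ {n} → Matrix Carrier n → Carrier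
  det {zero}  M = 1#
  det {suc n} M =
    sum {suc n} λ j → (- 1#) ^ toℕ j * (M zero j * det (λ r s → M (suc r) (punchIn j s)))

module Polynomials (R : RawRing c ℓ) where
  open RawRing R

  -- Lists of coefficients, constant term first.  Trailing zeros are allowed,
  -- so equality is equality of all coefficients.
  Poly : Set c
  Poly = List Carrier

  coeff : Poly → ℕ → Carrier
  coeff []      j       = 0#
  coeff (x ∷ f) zero    = x
  coeff (x ∷ f) (suc j) = coeff f j

  infixl 6 _+ₚ_
  infixl 7 _*ₚ_

  _+ₚ_ : Poly → Poly → Poly
  []      +ₚ g       = g
  (x ∷ f) +ₚ []      = x ∷ f
  (x ∷ f) +ₚ (y ∷ g) = (x + y) ∷ (f +ₚ g)

  _*ₚ_ : Poly → Poly → Poly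
  []      *ₚ g = []
  (x ∷ f) *ₚ g = map (x *_) g +ₚ (0# ∷ (f *ₚ g))

  const : Carrier → Poly
  const x = x ∷ []

  X : Poly
  X = 0# ∷ 1# ∷ []

  polyRawRing : RawRing c ℓ
  polyRawRing = record
    { Carrier = Poly
    ; _≈_     = λ f g → ∀ j → coeff f j ≈ coeff g j
    ; _+_     = _+ₚ_
    ; _*_     = _*ₚ_
    ; -_      = map (-_)
    ; 0#      = []
    ; 1#      = const 1#
    }

module OrthogonalPolynomials (K : HeytingField c ℓ₁ ℓ₂) where
  open HeytingField K

  rawRing : RawRing c ℓ₁
  rawRing = CommutativeRing.rawRing
    (HeytingCommutativeRing.commutativeRing heytingCommutativeRing)

  open RawSemiringOps (RawRing.rawSemiring rawRing) using (_^_)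
  open Determinant rawRing public using (det)
  open Polynomials rawRing

  private
    module K[x] where
      open RawRing polyRawRing public
      open RawSemiringOps rawSemiring public using (_^_)
      open Determinant polyRawRing public using (det)

  -- The library provides inverses of differences x - y with x # y;
  -- here y is 0#.
  inverse : ∀ {x} → x # 0# → Carrier
  inverse x#0 = proj₁ (#⇒invertible x#0)

  H : (ℕ → Carrier) → ℕ → Carrier
  H μ k = det {k} λ i j → μ (toℕ i ℕ.+ toℕ j)

  NonvanishingHankel : (ℕ → Carrier) → Set ℓ₂
  NonvanishingHankel μ = ∀ k → H μ k # 0#

  -- Rows 0, …, k-1 hold the moments μ(i+j); row k is 1, x, …, x^k.
  momentMatrix : (ℕ → Carrier) → (k : ℕ) → Matrix Poly (suc k)
  momentMatrix μ k i j =
    if toℕ i <ᵇ k then const (μ (toℕ i ℕ.+ toℕ j)) else X K[x].^ toℕ j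

  orthPoly : (μ : ℕ → Carrier) → NonvanishingHankel μ → ℕ → Poly
  orthPoly μ H#0 k = const (inverse (H#0 k)) K[x].* K[x].det (momentMatrix μ k)

  -- orthPoly k = Σ_{j ≤ k} (-1)^(k-j) p(k,j) x^j, solved for p(k,j) using
  -- that (-1)^(k-j) is its own inverse; p(k,j) = 0 for j > k.
  p : (μ : ℕ → Carrier) → NonvanishingHankel μ → ℕ → ℕ → Carrier
  p μ H#0 k j =
    if j ≤ᵇ k then (- 1#) ^ (k ∸ j) * coeff (orthPoly μ H#0 k) j else 0#

{-# OPTIONS --safe #-}
module Submission where

open import Defs
open import Algebra.Apartness.Bundles using (HeytingField; module HeytingCommutativeRing)
open import Algebra.Bundles using (CommutativeRing; module RawRing; module Semiring)
import Algebra.Definitions.RawSemiring as RawSemiringOps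
open import Data.Bool.Base using (true; false; if_then_else_; T)
open import Data.Fin.Base using (Fin; zero; suc; toℕ; punchIn; fromℕ<; _↑ˡ_; _↑ʳ_)
open import Data.Fin.Properties using (toℕ<n; toℕ-fromℕ<; toℕ-↑ˡ)
open import Data.Nat.Base as ℕ using (ℕ; zero; suc; z≤n; s≤s)
open import Data.Nat.Properties
  using (≤-trans; ≤-refl; ≤-reflexive; ≤-pred; <⇒≤; ≰⇒>; ≤-<-trans; <-≤-trans; <-≤-connex; <-cmp;
         m≤m+n; m≤n+m; m+[n∸m]≡n; +-suc; +-monoˡ-<; +-monoʳ-<; ≤ᵇ⇒≤; ≤⇒≤ᵇ)
  renaming (+-identityʳ to +-identityʳ-ℕ; +-comm to +-comm-ℕ; +-assoc to +-assoc-ℕ; *-comm to *-comm-ℕ)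
open import Data.Product.Base using (∃; _×_; _,_; proj₁; proj₂)
open import Data.Sum.Base using (_⊎_; inj₁; inj₂)
open import Data.Unit.Base using (tt)
open import Data.Vec.Functional using (Vector; tail; insertAt; removeAt)
open import Level using (_⊔_)
open import Relation.Binary.Definitions using (tri<; tri≈; tri>)
open import Relation.Binary.PropositionalEquality as ≡ using (_≡_)

-- Put N = n + m and let Q be the N × N matrix whose first m columns are
-- ((-1)^i μ(i+j))_i and whose remaining columns are unit vectors.  By
-- orthogonality the row vector p(m+i, ·) Q, for i < n, has its first m entries
-- zero and continues like row i of a lower unitriangular matrix.  Let A consist
-- of the n rows p(m+i, ·) followed by the unit rows e_n, …, e_{N-1}.  Peeling the
-- first n rows off A Q leaves ± det(μ(n+i+j)), while det A is the leading minor
-- det(p(m+i, j)) and det Q = ± H_m; the signs agree, so det(A Q) = det A · det Q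
-- is the claim.  In place of a theory of permutations, the determinant is
-- characterised as the alternating multilinear form taking the value 1 at the
-- identity matrix.

-- The signs in `Q` come from the definition of `p`: p(k,t) is (-1)^(k+t) times the coefficient of
-- x^t in p_k, and the factor (-1)^t has to be cancelled before the row p(k, ·) is orthogonal to a
-- column of moments. The identity det(A Q) = det A · det Q is not derived as a theorem on matrix
-- products: A ↦ det(A Q) is itself an alternating form, and uniqueness gives its value as det A
-- times its value at the identity. The polynomials p_k are determinants over raw coefficient lists,
-- for which no ring laws are established. They are reached only through linear functionals: a
-- functional passes through the defining determinant to its last row, so every fact about p_k
-- becomes a scalar determinant in which that row is zero, a unit vector or a repetition.

module DeterminantTheory {c ℓ} (R : CommutativeRing c ℓ) where
  open CommutativeRing R hiding (zero)
  open Determinant rawRing public using (det)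
  open import Algebra.Properties.CommutativeSemiring.Exp commutativeSemiring
  open import Algebra.Properties.Semiring.Sum semiring
  open import Algebra.Definitions.RawSemiring (Semiring.rawSemiring semiring) using (product)
  open import Algebra.Properties.Group +-group using (inverseˡ-unique)
  open import Algebra.Properties.Ring ring using (-1*x≈-x)
  open import Algebra.Solver.Ring.NaturalCoefficients.Default commutativeSemiring
    using (solve; _:=_; _:+_; _:*_; con)
  open import Data.Vec.Functional using (_∷_)
  open import Relation.Binary.Reasoning.Setoid setoid

  -- Signs and finite sums.

  ε : Carrier
  ε = - 1#

  ε*ε≈1 : ε * ε ≈ 1#
  ε*ε≈1 = begin
    ε * ε    ≈⟨ -1*x≈-x ε ⟩
    - ε      ≈⟨ inverseˡ-unique 1# ε (-‿inverseʳ 1#) ⟨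
    1#       ∎

  x+εx≈0 : ∀ x → x + ε * x ≈ 0#
  x+εx≈0 x = trans (+-congˡ (-1*x≈-x x)) (-‿inverseʳ x)

  x+y≈0⇒x≈εy : ∀ {x y} → x + y ≈ 0# → x ≈ ε * y
  x+y≈0⇒x≈εy {x} {y} eq = trans (inverseˡ-unique x y eq) (sym (-1*x≈-x y))

  sum-cong : ∀ {n} {f g : Vector Carrier n} → (∀ i → f i ≈ g i) → sum f ≈ sum g
  sum-cong = sum-cong-≋

  sum-zero : ∀ {n} {v : Vector Carrier n} → (∀ i → v i ≈ 0#) → sum v ≈ 0#
  sum-zero {n} eq = trans (sum-cong eq) (sum-replicate-zero n)

  -- Alternating multilinear forms on the rows of a matrix.

  Row : ℕ → Set c
  Row = Vector Carrier

  infix 4 _≐_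

  _≐_ : ∀ {n k} → Vector (Row k) n → Vector (Row k) n → Set ℓ
  M ≐ N = ∀ i j → M i j ≈ N i j

  -- The number of rows and their length are separate parameters because holding a row fixed lowers
  -- the former and keeps the latter.
  Form : ℕ → ℕ → Set c
  Form n k = Vector (Row k) n → Carrier

  Congruent : ∀ {n k} → Form n k → Set (c ⊔ ℓ)
  Congruent f = ∀ {M N} → M ≐ N → f M ≈ f N

  record Linear {k} (g : Row k → Carrier) : Set (c ⊔ ℓ) where
    field
      cong   : ∀ {u v} → (∀ t → u t ≈ v t) → g u ≈ g v
      +-homo : ∀ u v → g (λ t → u t + v t) ≈ g u + g v
      *-homo : ∀ a u → g (λ t → a * u t) ≈ a * g u

    0-homo : ∀ {u} → (∀ t → u t ≈ 0#) → g u ≈ 0#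
    0-homo {u} u≈0 = begin
      g u                  ≈⟨ cong (λ t → trans (u≈0 t) (sym (zeroˡ 0#))) ⟩
      g (λ _ → 0# * 0#)    ≈⟨ *-homo 0# (λ _ → 0#) ⟩
      0# * g (λ _ → 0#)    ≈⟨ zeroˡ _ ⟩
      0#                   ∎

    sum-homo : ∀ {n} (a : Vector Carrier n) (w : Fin n → Row k) →
               g (λ t → sum (λ i → a i * w i t)) ≈ sum (λ i → a i * g (w i))
    sum-homo {zero}  a w = 0-homo λ _ → refl
    sum-homo {suc n} a w = trans (+-homo _ _)
      (+-cong (*-homo _ _) (sum-homo (tail a) (tail w)))

  ∷-cong : ∀ {n k} {u v : Row k} {M N : Vector (Row k) n} →
           (∀ t → u t ≈ v t) → M ≐ N → (u ∷ M) ≐ (v ∷ N)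
  ∷-cong u≈v M≐N zero    = u≈v
  ∷-cong u≈v M≐N (suc i) = M≐N i

  ∷-η : ∀ {n k} (M : Vector (Row k) (suc n)) → M ≐ (M zero ∷ tail M)
  ∷-η M zero    j = refl
  ∷-η M (suc i) j = refl

  ≐-refl : ∀ {n k} {M : Vector (Row k) n} → M ≐ M
  ≐-refl i j = refl

  -- Multilinearity and alternation by recursion on the number of rows: the first
  -- row is free, then it is held fixed.
  data Alternating {k} : ∀ {n} → Form n k → Set (c ⊔ ℓ) where
    nullary : {f : Form 0 k} → Congruent f → Alternating f
    step    : ∀ {n} {f : Form (suc n) k} →
              Congruent f →
              (∀ M → Linear λ v → f (v ∷ M)) →
              (∀ {v M} i → (∀ t → v t ≈ M i t) → f (v ∷ M) ≈ 0#) →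
              (∀ v → Alternating λ M → f (v ∷ M)) →
              Alternating f

  congruent : ∀ {n k} {f : Form n k} → Alternating f → Congruent f
  congruent (nullary f-cong)    = f-cong
  congruent (step f-cong _ _ _) = f-cong

  linear : ∀ {n k} {f : Form (suc n) k} → Alternating f → ∀ M → Linear λ v → f (v ∷ M)
  linear (step _ f-linear _ _) = f-linear

  repeated⇒0 : ∀ {n k} {f : Form (suc n) k} → Alternating f →
               ∀ {v M} i → (∀ t → v t ≈ M i t) → f (v ∷ M) ≈ 0#
  repeated⇒0 (step _ _ f-repeated _) = f-repeated

  fix-head : ∀ {n k} {f : Form (suc n) k} → Alternating f → ∀ v → Alternating λ M → f (v ∷ M)
  fix-head (step _ _ _ f-tail) = f-tail

  -- Polarisation: expand the vanishing value at two equal rows `u+v`. The hypotheses are listed one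
  -- by one because `adjacent` needs the swap while `Alternating f` is still to be proved.
  swap′ : ∀ {n k} (f : Form (suc (suc n)) k) →
          (∀ M → Linear λ v → f (v ∷ M)) →
          (∀ v M → Linear λ w → f (v ∷ w ∷ M)) →
          (∀ v M → f (v ∷ v ∷ M) ≈ 0#) →
          ∀ u v M → f (u ∷ v ∷ M) ≈ ε * f (v ∷ u ∷ M)
  swap′ f lin₁ lin₂ rep u v M = x+y≈0⇒x≈εy (begin
    f (u ∷ v ∷ M) + f (v ∷ u ∷ M)
      ≈⟨ +-cong (trans (+-congʳ (rep u M)) (+-identityˡ _)) (trans (+-congˡ (rep v M)) (+-identityʳ _)) ⟨
    (f (u ∷ u ∷ M) + f (u ∷ v ∷ M)) + (f (v ∷ u ∷ M) + f (v ∷ v ∷ M))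
      ≈⟨ +-cong (Linear.+-homo (lin₂ u M) u v) (Linear.+-homo (lin₂ v M) u v) ⟨
    f (u ∷ u+v ∷ M) + f (v ∷ u+v ∷ M)
      ≈⟨ Linear.+-homo (lin₁ (u+v ∷ M)) u v ⟨
    f (u+v ∷ u+v ∷ M)
      ≈⟨ rep u+v M ⟩
    0# ∎)
    where
    u+v : Row _
    u+v t = u t + v t

  swap : ∀ {n k} {f : Form (suc (suc n)) k} → Alternating f →
         ∀ u v M → f (u ∷ v ∷ M) ≈ ε * f (v ∷ u ∷ M)
  swap {f = f} alt = swap′ f (linear alt) (λ v → linear (fix-head alt v))
    (λ v M → repeated⇒0 alt {v} {v ∷ M} zero (λ _ → refl))

  -- Equality of the first two rows is the only coincidence that has to be tested. If `v` equals a
  -- deeper row, swapping the first two rows moves `v` into the part governed by the alternation of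
  -- the remaining rows.
  adjacent : ∀ {n k} {f : Form (suc (suc n)) k} →
             Congruent f →
             (∀ M → Linear λ v → f (v ∷ M)) →
             (∀ v M → f (v ∷ v ∷ M) ≈ 0#) →
             (∀ v → Alternating λ M → f (v ∷ M)) →
             Alternating f
  adjacent {f = f} f-cong lin rep tl = step f-cong lin rep′ tl
    where
    rep′ : ∀ {v M} i → (∀ t → v t ≈ M i t) → f (v ∷ M) ≈ 0#
    rep′ {v} {M} zero v≈M₀ = trans
      (f-cong (∷-cong (λ _ → refl) (λ { zero t → sym (v≈M₀ t) ; (suc i) t → refl })))
      (rep v (tail M))
    rep′ {v} {M} (suc i) v≈Mᵢ = begin
      f (v ∷ M)                    ≈⟨ f-cong (∷-cong (λ _ → refl) (∷-η M)) ⟩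
      f (v ∷ M zero ∷ tail M)      ≈⟨ swap′ f lin (λ w → linear (tl w)) rep v (M zero) (tail M) ⟩
      ε * f (M zero ∷ v ∷ tail M)  ≈⟨ *-congˡ (repeated⇒0 (tl (M zero)) i v≈Mᵢ) ⟩
      ε * 0#                       ≈⟨ zeroʳ ε ⟩
      0#                           ∎

  -- Closure properties of linear and alternating forms.

  Linear-resp : ∀ {k} {g h : Row k → Carrier} → (∀ v → g v ≈ h v) → Linear g → Linear h
  Linear-resp g≈h lin = record
    { cong   = λ eq → trans (sym (g≈h _)) (trans (cong eq) (g≈h _))
    ; +-homo = λ u v → trans (sym (g≈h _)) (trans (+-homo u v) (+-cong (g≈h u) (g≈h v)))
    ; *-homo = λ a u → trans (sym (g≈h _)) (trans (*-homo a u) (*-congˡ (g≈h u)))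
    } where open Linear lin

  Linear-0 : ∀ {k} → Linear {k} λ _ → 0#
  Linear-0 = record
    { cong   = λ _ → refl
    ; +-homo = λ _ _ → sym (+-identityˡ 0#)
    ; *-homo = λ a _ → sym (zeroʳ a)
    }

  Linear-+ : ∀ {k} {g h : Row k → Carrier} → Linear g → Linear h → Linear λ v → g v + h v
  Linear-+ {g = g} {h} lin-g lin-h = record
    { cong   = λ eq → +-cong (G.cong eq) (H.cong eq)
    ; +-homo = λ u v → trans (+-cong (G.+-homo u v) (H.+-homo u v))
        (solve 4 (λ a b c d → (a :+ b) :+ (c :+ d) := (a :+ c) :+ (b :+ d)) refl (g u) (g v) (h u) (h v))
    ; *-homo = λ a u → trans (+-cong (G.*-homo a u) (H.*-homo a u)) (sym (distribˡ a _ _))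
    }
    where
    module G = Linear lin-g
    module H = Linear lin-h

  Linear-* : ∀ {k} {g : Row k → Carrier} a → Linear g → Linear λ v → a * g v
  Linear-* {g = g} a lin = record
    { cong   = λ eq → *-congˡ (cong eq)
    ; +-homo = λ u v → trans (*-congˡ (+-homo u v)) (distribˡ a _ _)
    ; *-homo = λ b u → trans (*-congˡ (*-homo b u))
        (solve 3 (λ a b x → a :* (b :* x) := b :* (a :* x)) refl a b (g u))
    } where open Linear lin

  Linear-sum : ∀ {n k} {g : Fin n → Row k → Carrier} → (∀ i → Linear (g i)) →
               Linear λ v → sum (λ i → g i v)
  Linear-sum {zero}  lin = Linear-0
  Linear-sum {suc n} lin = Linear-+ (lin zero) (Linear-sum (λ i → lin (suc i)))

  Linear-entry : ∀ {k} (j : Fin k) → Linear λ v → v j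
  Linear-entry j = record
    { cong = λ eq → eq j ; +-homo = λ _ _ → refl ; *-homo = λ _ _ → refl }

  Linear-*ʳ : ∀ {k} {g : Row k → Carrier} a → Linear g → Linear λ v → g v * a
  Linear-*ʳ a lin = Linear-resp (λ _ → *-comm a _) (Linear-* a lin)

  Alternating-resp : ∀ {n k} {f g : Form n k} → (∀ M → f M ≈ g M) → Alternating f → Alternating g
  Alternating-resp f≈g (nullary f-cong) =
    nullary λ eq → trans (sym (f≈g _)) (trans (f-cong eq) (f≈g _))
  Alternating-resp f≈g (step f-cong lin rep tl) = step
    (λ eq → trans (sym (f≈g _)) (trans (f-cong eq) (f≈g _)))
    (λ M → Linear-resp (λ v → f≈g (v ∷ M)) (lin M))
    (λ i eq → trans (sym (f≈g _)) (rep i eq))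
    (λ v → Alternating-resp (λ M → f≈g (v ∷ M)) (tl v))

  Alternating-0 : ∀ {n k} → Alternating {k} {n} λ _ → 0#
  Alternating-0 {zero}  = nullary λ _ → refl
  Alternating-0 {suc n} = step (λ _ → refl) (λ _ → Linear-0) (λ _ _ → refl) (λ _ → Alternating-0)

  Alternating-+ : ∀ {n k} {f g : Form n k} → Alternating f → Alternating g →
                  Alternating λ M → f M + g M
  Alternating-+ (nullary f-cong) (nullary g-cong) = nullary λ eq → +-cong (f-cong eq) (g-cong eq)
  Alternating-+ (step f-cong f-lin f-rep f-tl) (step g-cong g-lin g-rep g-tl) = step
    (λ eq → +-cong (f-cong eq) (g-cong eq))
    (λ M → Linear-+ (f-lin M) (g-lin M))
    (λ i eq → trans (+-cong (f-rep i eq) (g-rep i eq)) (+-identityˡ 0#))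
    (λ v → Alternating-+ (f-tl v) (g-tl v))

  Alternating-* : ∀ {n k} {f : Form n k} a → Alternating f → Alternating λ M → a * f M
  Alternating-* a (nullary f-cong) = nullary λ eq → *-congˡ (f-cong eq)
  Alternating-* a (step f-cong lin rep tl) = step
    (λ eq → *-congˡ (f-cong eq))
    (λ M → Linear-* a (lin M))
    (λ i eq → trans (*-congˡ (rep i eq)) (zeroʳ a))
    (λ v → Alternating-* a (tl v))

  Alternating-sum : ∀ {m n k} {f : Fin m → Form n k} → (∀ j → Alternating (f j)) →
                    Alternating λ M → sum (λ j → f j M)
  Alternating-sum {zero}  alt = Alternating-0
  Alternating-sum {suc m} alt = Alternating-+ (alt zero) (Alternating-sum (λ j → alt (suc j)))

  LinearMap : ∀ {k l} → (Row k → Row l) → Set (c ⊔ ℓ)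
  LinearMap T = ∀ t → Linear λ v → T v t

  Linear-∘ : ∀ {k l} {T : Row k → Row l} → LinearMap T → {g : Row l → Carrier} → Linear g →
             Linear λ v → g (T v)
  Linear-∘ {T = T} T-lin lin = record
    { cong   = λ eq → cong λ t → Linear.cong (T-lin t) eq
    ; +-homo = λ u v → trans (cong λ t → Linear.+-homo (T-lin t) u v) (+-homo (T u) (T v))
    ; *-homo = λ a u → trans (cong λ t → Linear.*-homo (T-lin t) a u) (*-homo a (T u))
    } where open Linear lin

  -- Serves for every operation on columns used below: deleting a column, inserting a zero column,
  -- padding with zeros and multiplying by `Q` from the right.
  pullback : ∀ {n k l} {T : Row k → Row l} → LinearMap T → {f : Form n l} → Alternating f →
             Alternating λ M → f (λ i → T (M i))
  pullback T-lin (nullary f-cong) = nullary λ eq → f-cong λ ()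
  pullback {T = T} T-lin {f} (step f-cong lin rep tl) = step
    (λ eq → f-cong λ i t → Linear.cong (T-lin t) (eq i))
    (λ M → Linear-resp (λ v → sym (∷-map v M)) (Linear-∘ T-lin (lin (λ i → T (M i)))))
    (λ {v} {M} i eq → trans (∷-map v M) (rep i (λ t → Linear.cong (T-lin t) eq)))
    (λ v → Alternating-resp (λ M → sym (∷-map v M)) (pullback T-lin (tl (T v))))
    where
    ∷-map : ∀ v M → f (λ i → T ((v ∷ M) i)) ≈ f (T v ∷ λ i → T (M i))
    ∷-map v M = f-cong λ { zero t → refl ; (suc i) t → refl }

  -- The determinant is alternating.

  det-cong : ∀ {n} → Congruent (det {n})
  det-cong {zero}  eq = refl
  det-cong {suc n} {M} {N} eq = sum-cong λ j → *-congˡ {ε ^ toℕ j}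
    (*-cong (eq zero j) (det-cong λ r s → eq (suc r) (punchIn j s)))

  -- The double cofactor expansion along two equal rows: the pairs of columns
  -- (a , b) and (b , a) contribute opposite terms.  Column 0 is split off.
  expand-twice : ∀ {n} (v : Row (suc (suc n))) (D : (Fin n → Fin (suc (suc n))) → Carrier) →
    (∀ g h → (∀ t → g t ≡ h t) → D g ≈ D h) →
    sum (λ j → ε ^ toℕ j * (v j * sum (λ s → ε ^ toℕ s *
      (v (punchIn j s) * D (λ t → punchIn j (punchIn s t)))))) ≈ 0#
  expand-twice {n} v D D-cong = begin
    1# * (v₀ * S) + sum (λ j → ε * ε ^ toℕ j * (v (suc j) * (1# * (v₀ * d j) + inner j)))
      ≈⟨ +-cong (*-identityˡ _)
           (sum-cong {g = λ j → ε * (v₀ * a j) + rest j} λ j → solve 6 (λ e x b a d i →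
              (e :* x) :* (b :* (con 1 :* (a :* d) :+ i)) := e :* (a :* (x :* (b :* d))) :+ (e :* x) :* (b :* i))
              refl ε (ε ^ toℕ j) (v (suc j)) v₀ (d j) (inner j)) ⟩
    v₀ * S + sum (λ j → ε * (v₀ * a j) + rest j)
      ≈⟨ +-congˡ (∑-distrib-+ (λ j → ε * (v₀ * a j)) rest) ⟩
    v₀ * S + (sum (λ j → ε * (v₀ * a j)) + sum rest)
      ≈⟨ +-congˡ (+-cong
           (trans (*-congˡ (*-distribˡ-sum v₀ a)) (*-distribˡ-sum ε (λ j → v₀ * a j)))
           (sym (rest≈0 v D D-cong))) ⟨
    v₀ * S + (ε * (v₀ * S) + 0#)
      ≈⟨ trans (+-congˡ (+-identityʳ _)) (x+εx≈0 _) ⟩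
    0# ∎
    where
    v₀ : Carrier
    v₀ = v zero
    d a inner rest : Fin (suc n) → Carrier
    d j = D (λ t → suc (punchIn j t))
    a j = ε ^ toℕ j * (v (suc j) * d j)
    inner j = sum {n} (λ s → ε * ε ^ toℕ s *
      (v (suc (punchIn j s)) * D (λ t → punchIn (suc j) (punchIn (suc s) t))))
    rest j = ε * ε ^ toℕ j * (v (suc j) * inner j)
    S : Carrier
    S = sum a
    rest≈0 : ∀ {n} (v : Row (suc (suc n))) (D : (Fin n → Fin (suc (suc n))) → Carrier) →
      (∀ g h → (∀ t → g t ≡ h t) → D g ≈ D h) →
      sum (λ j → ε * ε ^ toℕ j * (v (suc j) * sum {n} (λ s → ε * ε ^ toℕ s *
      (v (suc (punchIn j s)) * D (λ t → punchIn (suc j) (punchIn (suc s) t)))))) ≈ 0#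
    rest≈0 {zero}  v D D-cong = sum-zero {1} λ j →
      trans (*-congˡ {ε * ε ^ toℕ j} (zeroʳ (v (suc j)))) (zeroʳ (ε * ε ^ toℕ j))
    -- When neither removed column is column 0, both column indices are shifted by one and the two
    -- extra factors `ε` cancel. Column 0 then survives in every minor; `D′` builds it in, and the
    -- sum becomes the double expansion of `tail v`.
    rest≈0 {suc n} v D D-cong = trans (sum-cong {g = λ j → ε ^ toℕ j * (v (suc j) * sum (b j))} λ j → begin
      ε * ε ^ toℕ j * (v (suc j) * sum (λ s → ε * ε ^ toℕ s *
        (v (suc (punchIn j s)) * D (λ t → punchIn (suc j) (punchIn (suc s) t)))))
        ≈⟨ *-congˡ {ε * ε ^ toℕ j} (*-congˡ {v (suc j)} (trans
             (sum-cong {g = λ s → ε * b j s} λ s → trans (*-assoc ε (ε ^ toℕ s) _)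
               (*-congˡ {ε} (*-congˡ {ε ^ toℕ s} (*-congˡ {v (suc (punchIn j s))}
                 (D-cong (λ t → punchIn (suc j) (punchIn (suc s) t)) _ λ { zero → ≡.refl ; (suc t) → ≡.refl })))))
             (sym (*-distribˡ-sum ε (b j))))) ⟩
      ε * ε ^ toℕ j * (v (suc j) * (ε * sum (b j)))
        ≈⟨ solve 4 (λ e x b y → (e :* x) :* (b :* (e :* y)) := (e :* e) :* (x :* (b :* y)))
             refl ε (ε ^ toℕ j) (v (suc j)) (sum (b j)) ⟩
      ε * ε * (ε ^ toℕ j * (v (suc j) * sum (b j)))
        ≈⟨ trans (*-congʳ ε*ε≈1) (*-identityˡ _) ⟩
      ε ^ toℕ j * (v (suc j) * sum (b j)) ∎)
      (expand-twice (tail v) D′ λ g h eq → D-cong _ _ λ { zero → ≡.refl ; (suc t) → ≡.cong suc (eq t) })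
      where
      D′ : (Fin n → Fin (suc (suc n))) → Carrier
      D′ h = D (λ { zero → zero ; (suc t) → suc (h t) })
      b : Fin (suc (suc n)) → Fin (suc n) → Carrier
      b j s = ε ^ toℕ s * (v (suc (punchIn j s)) * D′ (λ t → punchIn j (punchIn s t)))

  -- With the first row fixed, the Laplace expansion is a linear combination of minors, each a
  -- smaller determinant pulled back along the deletion of a column. What remains is a repetition in
  -- the first two rows, settled by `expand-twice`.
  det-alternating : ∀ {n} → Alternating (det {n})
  det-alternating {zero} = nullary det-cong
  det-alternating {suc n} = alternating n det-fix-head
    where
    det-fix-head : ∀ v → Alternating λ M → det {suc n} (v ∷ M)
    det-fix-head v = Alternating-sum λ j → Alternating-* (ε ^ toℕ j) (Alternating-* (v j)
      (pullback (λ t → Linear-entry (punchIn j t)) det-alternating))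
    det-linear : ∀ {n} M → Linear λ v → det {suc n} (v ∷ M)
    det-linear M = Linear-sum λ j → Linear-* (ε ^ toℕ j) (Linear-*ʳ (det λ r s → M r (punchIn j s)) (Linear-entry j))
    alternating : ∀ n → (∀ v → Alternating λ M → det {suc n} (v ∷ M)) → Alternating (det {suc n})
    alternating zero    tl = step det-cong det-linear (λ ()) tl
    alternating (suc n) tl = adjacent det-cong det-linear
      (λ v M → expand-twice v (λ h → det (λ r t → M r (h t)))
         λ g h eq → det-cong λ r t → reflexive (≡.cong (M r) (eq t)))
      tl

  -- Unit vectors and the uniqueness of alternating forms.

  -- Indexed by natural numbers, so that one function gives the unit rows of every size and at every
  -- offset.
  δ : ℕ → ℕ → Carrier
  δ zero    zero    = 1#
  δ zero    (suc j) = 0#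
  δ (suc i) zero    = 0#
  δ (suc i) (suc j) = δ i j

  δ-diag : ∀ i → δ i i ≡ 1#
  δ-diag zero    = ≡.refl
  δ-diag (suc i) = δ-diag i

  δ-< : ∀ {i j} → i ℕ.< j → δ i j ≡ 0#
  δ-< {zero}  (s≤s i<j) = ≡.refl
  δ-< {suc i} (s≤s i<j) = δ-< i<j

  δ-> : ∀ {i j} → j ℕ.< i → δ i j ≡ 0#
  δ-> {j = zero}  (s≤s j<i) = ≡.refl
  δ-> {j = suc j} (s≤s j<i) = δ-> j<i

  identity : ∀ {n} → Vector (Row n) n
  identity i t = δ (toℕ i) (toℕ t)

  sum-δ : ∀ {n} (v : Row n) t → sum (λ i → v i * δ (toℕ i) (toℕ t)) ≈ v t
  sum-δ {suc n} v zero    = trans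
    (+-cong (*-identityʳ _) (sum-zero {n} λ i → zeroʳ (v (suc i)))) (+-identityʳ _)
  sum-δ {suc n} v (suc t) = trans (+-cong (zeroʳ _) (sum-δ (tail v) t)) (+-identityˡ _)

  expand-in-basis : ∀ {k} {g : Row k → Carrier} → Linear g →
                    ∀ v → g v ≈ sum (λ i → v i * g (identity i))
  expand-in-basis lin v = trans (cong λ t → sym (sum-δ v t)) (sum-homo v identity)
    where open Linear lin

  -- Once the second row is cleared by linearity, a swap carries `v` past it and the recursion runs
  -- with that row fixed. Swapping back cancels the sign.
  add-head-multiples : ∀ {n k} {f : Form (suc n) k} → Alternating f → ∀ v M (c : Vector Carrier n) →
                       f (v ∷ λ i t → M i t + c i * v t) ≈ f (v ∷ M)
  add-head-multiples {zero}  {f = f} alt v M c = congruent alt (∷-cong (λ _ → refl) λ ())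
  add-head-multiples {suc n} {f = f} alt v M c = begin
    f (v ∷ λ i t → M i t + c i * v t)
      ≈⟨ congruent alt (∷-cong (λ _ → refl) (∷-η _)) ⟩
    f (v ∷ (λ t → M zero t + c zero * v t) ∷ M″)
      ≈⟨ trans (+-homo (M zero) (λ t → c zero * v t)) (+-congˡ (*-homo (c zero) v)) ⟩
    f (v ∷ M zero ∷ M″) + c zero * f (v ∷ v ∷ M″)
      ≈⟨ +-congˡ (trans (*-congˡ (repeated⇒0 alt {v} {v ∷ M″} zero (λ _ → refl))) (zeroʳ _)) ⟩
    f (v ∷ M zero ∷ M″) + 0#
      ≈⟨ trans (+-identityʳ _) (swap alt v (M zero) M″) ⟩
    ε * f (M zero ∷ v ∷ M″)
      ≈⟨ *-congˡ (add-head-multiples (fix-head alt (M zero)) v (tail M) (tail c)) ⟩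
    ε * f (M zero ∷ v ∷ tail M)
      ≈⟨ swap alt v (M zero) (tail M) ⟨
    f (v ∷ M zero ∷ tail M)
      ≈⟨ congruent alt (∷-cong (λ _ → refl) (∷-η M)) ⟨
    f (v ∷ M) ∎
    where
    M″ : Vector (Row _) n
    M″ i t = M (suc i) t + c (suc i) * v t
    open Linear (linear (fix-head alt v) M″)

  -- The cycle that lifts row `j` to the top is made of `j` adjacent swaps. It is the only kind of
  -- permutation that uniqueness requires.
  move-to-front : ∀ {n k} {f : Form (suc n) k} → Alternating f → ∀ M j →
                  f (M j ∷ λ i → M (punchIn j i)) ≈ ε ^ toℕ j * f M
  move-to-front {f = f} alt M zero = trans (congruent alt λ i t → sym (∷-η M i t)) (sym (*-identityˡ _))
  move-to-front {suc n} {f = f} alt M (suc j) = begin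
    f (M (suc j) ∷ λ i → M (punchIn (suc j) i))
      ≈⟨ congruent alt (∷-cong (λ _ → refl) (∷-η _)) ⟩
    f (M (suc j) ∷ M zero ∷ λ i → M (suc (punchIn j i)))
      ≈⟨ swap alt _ _ _ ⟩
    ε * f (M zero ∷ M (suc j) ∷ λ i → M (suc (punchIn j i)))
      ≈⟨ *-congˡ (move-to-front (fix-head alt (M zero)) (tail M) j) ⟩
    ε * (ε ^ toℕ j * f (M zero ∷ tail M))
      ≈⟨ *-assoc _ _ _ ⟨
    ε * ε ^ toℕ j * f (M zero ∷ tail M)
      ≈⟨ *-congˡ (congruent alt (∷-η M)) ⟨
    ε * ε ^ toℕ j * f M ∎

  Linear-insertAt : ∀ {n} (j : Fin (suc n)) → LinearMap {n} λ w → insertAt w j 0#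
  Linear-insertAt zero zero = Linear-0
  Linear-insertAt zero (suc t) = Linear-entry t
  Linear-insertAt {suc n} (suc j) zero = Linear-entry zero
  Linear-insertAt {suc n} (suc j) (suc t) =
    Linear-∘ {T = tail} (λ t → Linear-entry (suc t)) (Linear-insertAt j t)

  insertAt-removeAt-δ : ∀ {n} (w : Row (suc n)) j t →
    insertAt (removeAt w j) j 0# t + w j * δ (toℕ j) (toℕ t) ≈ w t
  insertAt-removeAt-δ w zero zero = trans (+-identityˡ _) (*-identityʳ _)
  insertAt-removeAt-δ w zero (suc t) = trans (+-congˡ (zeroʳ _)) (+-identityʳ _)
  insertAt-removeAt-δ {suc n} w (suc j) zero = trans (+-congˡ (zeroʳ _)) (+-identityʳ _)
  insertAt-removeAt-δ {suc n} w (suc j) (suc t) = insertAt-removeAt-δ (tail w) j t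

  insertAt-δ : ∀ {n} (i : Fin n) j t → insertAt (identity i) j 0# t ≈ identity (punchIn j i) t
  insertAt-δ i zero zero = refl
  insertAt-δ i zero (suc t) = refl
  insertAt-δ zero (suc j) zero = refl
  insertAt-δ zero (suc j) (suc t) = insertAt-0 j t
    where
    insertAt-0 : ∀ {n} (j t : Fin (suc n)) → insertAt {n = n} (λ _ → 0#) j 0# t ≈ 0#
    insertAt-0 zero zero = refl
    insertAt-0 zero (suc t) = refl
    insertAt-0 {suc n} (suc j) zero = refl
    insertAt-0 {suc n} (suc j) (suc t) = insertAt-0 j t
  insertAt-δ (suc i) (suc j) zero = refl
  insertAt-δ (suc i) (suc j) (suc t) = insertAt-δ i j t

  -- Expanding the first row in unit vectors leaves heads `identity j`. Multiples of such a head
  -- clear column `j` in the rows below, so the value depends only on the minor, as an alternating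
  -- form of smaller size. Moving row `j` of the identity to the front supplies the sign, and the
  -- result is the Laplace expansion.
  alternating-unique : ∀ {n} {f : Form n n} → Alternating f → ∀ A → f A ≈ det A * f identity
  alternating-unique {zero}  alt A = trans (congruent alt λ ()) (sym (*-identityˡ _))
  alternating-unique {suc n} {f} alt A = begin
    f A
      ≈⟨ congruent alt (∷-η A) ⟩
    f (A zero ∷ tail A)
      ≈⟨ expand-in-basis (linear alt (tail A)) (A zero) ⟩
    sum (λ j → A zero j * f (identity j ∷ tail A))
      ≈⟨ sum-cong (λ j → trans (*-congˡ {A zero j} (cofactor j))
           (solve 4 (λ e a d x → a :* (d :* (e :* x)) := (e :* (a :* d)) :* x)
              refl (ε ^ toℕ j) (A zero j) (det (minor j)) (f identity))) ⟩
    sum (λ j → ε ^ toℕ j * (A zero j * det (minor j)) * f identity)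
      ≈⟨ *-distribʳ-sum (f identity) (λ j → ε ^ toℕ j * (A zero j * det (minor j))) ⟨
    det A * f identity ∎
    where
    minor : Fin (suc n) → Vector (Row n) n
    minor j i = removeAt (A (suc i)) j
    cofactor : ∀ j → f (identity j ∷ tail A) ≈ det (minor j) * (ε ^ toℕ j * f identity)
    cofactor j = begin
      f (identity j ∷ tail A)
        ≈⟨ congruent alt (∷-cong (λ _ → refl) λ i → insertAt-removeAt-δ (A (suc i)) j) ⟨
      f (identity j ∷ λ i t → insertAt (minor j i) j 0# t + A (suc i) j * identity j t)
        ≈⟨ add-head-multiples alt (identity j) (λ i → insertAt (minor j i) j 0#) (λ i → A (suc i) j) ⟩
      f (identity j ∷ λ i → insertAt (minor j i) j 0#)
        ≈⟨ alternating-unique (pullback (Linear-insertAt j) (fix-head alt (identity j))) (minor j) ⟩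
      det (minor j) * f (identity j ∷ λ i → insertAt (identity i) j 0#)
        ≈⟨ *-congˡ (congruent alt (∷-cong (λ _ → refl) λ i → insertAt-δ i j)) ⟩
      det (minor j) * f (identity j ∷ λ i → identity (punchIn j i))
        ≈⟨ *-congˡ (move-to-front alt identity j) ⟩
      det (minor j) * (ε ^ toℕ j * f identity) ∎

  -- Matrices in blocks of rows.

  -- Unlike the library's _++_, this computes on the first index, so that
  -- (v ∷ M) ⧺ E is definitionally v ∷ (M ⧺ E).
  infixr 5 _⧺_

  _⧺_ : ∀ {a} {A : Set a} {n m} → Vector A n → Vector A m → Vector A (n ℕ.+ m)
  _⧺_ {n = zero}  M E = E
  _⧺_ {n = suc n} M E = M zero ∷ (tail M ⧺ E)

  module _ {a} {A : Set a} where
    ⧺-↑ˡ : ∀ {n m} (M : Vector A n) (E : Vector A m) i → (M ⧺ E) (i ↑ˡ m) ≡ M i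
    ⧺-↑ˡ M E zero    = ≡.refl
    ⧺-↑ˡ M E (suc i) = ⧺-↑ˡ (tail M) E i

    ⧺-↑ʳ : ∀ {n m} (M : Vector A n) (E : Vector A m) s → (M ⧺ E) (n ↑ʳ s) ≡ E s
    ⧺-↑ʳ {zero}  M E s = ≡.refl
    ⧺-↑ʳ {suc n} M E s = ⧺-↑ʳ (tail M) E s

    ⧺-toℕ : ∀ n {m} (F : ℕ → A) i →
            ((λ (r : Fin n) → F (toℕ r)) ⧺ (λ (s : Fin m) → F (n ℕ.+ toℕ s))) i ≡ F (toℕ i)
    ⧺-toℕ zero    F i       = ≡.refl
    ⧺-toℕ (suc n) F zero    = ≡.refl
    ⧺-toℕ (suc n) F (suc i) = ⧺-toℕ n (λ r → F (suc r)) i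

    ⧺-map : ∀ {b} {B : Set b} (T : A → B) {n m} (M : Vector A n) (E : Vector A m) i →
            T ((M ⧺ E) i) ≡ ((λ r → T (M r)) ⧺ (λ s → T (E s))) i
    ⧺-map T {zero}  M E i       = ≡.refl
    ⧺-map T {suc n} M E zero    = ≡.refl
    ⧺-map T {suc n} M E (suc i) = ⧺-map T (tail M) E i

  ⧺-cong : ∀ {n m k} {M N : Vector (Row k) n} {E F : Vector (Row k) m} →
           M ≐ N → E ≐ F → (M ⧺ E) ≐ (N ⧺ F)
  ⧺-cong {zero}  M≐N E≐F i       = E≐F i
  ⧺-cong {suc n} M≐N E≐F zero    = M≐N zero
  ⧺-cong {suc n} M≐N E≐F (suc i) = ⧺-cong (λ r → M≐N (suc r)) E≐F i

  -- `Alternating` releases rows from the front only; this freezes a block at the end, so that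
  -- uniqueness can be applied to the rows above it.
  fix-last : ∀ {n m k} {f : Form (n ℕ.+ m) k} → Alternating f → ∀ E → Alternating {n = n} λ M → f (M ⧺ E)
  fix-last {zero} alt E = nullary λ _ → refl
  fix-last {suc n} {m} alt E = step
    (λ eq → congruent alt (⧺-cong eq ≐-refl))
    (λ M → linear alt (M ⧺ E))
    (λ {v} {M} i eq → repeated⇒0 alt {v} {M ⧺ E} (i ↑ˡ m) λ t →
      trans (eq t) (reflexive (≡.cong-app (≡.sym (⧺-↑ˡ M E i)) t)))
    (λ v → fix-last (fix-head alt v) E)

  repeated-⧺⇒0 : ∀ {n m k} {f : Form (n ℕ.+ m) k} → Alternating f →
                 ∀ (M : Vector (Row k) n) (E : Vector (Row k) m) i s →
                 (∀ t → M i t ≈ E s t) → f (M ⧺ E) ≈ 0#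
  repeated-⧺⇒0 {suc n} alt M E zero s eq = repeated⇒0 alt {M zero} {tail M ⧺ E} (n ↑ʳ s) λ t →
    trans (eq t) (reflexive (≡.cong-app (≡.sym (⧺-↑ʳ (tail M) E s)) t))
  repeated-⧺⇒0 {suc n} alt M E (suc i) s eq = repeated-⧺⇒0 (fix-head alt (M zero)) (tail M) E i s eq

  zero-row-⧺⇒0 : ∀ {n m k} {f : Form (n ℕ.+ suc m) k} → Alternating f → ∀ (M : Vector (Row k) n) E →
                 (∀ t → E zero t ≈ 0#) → f (M ⧺ E) ≈ 0#
  zero-row-⧺⇒0 {zero}  alt M E eq =
    trans (congruent alt (∷-η E)) (Linear.0-homo (linear alt (tail E)) eq)
  zero-row-⧺⇒0 {suc n} alt M E eq = zero-row-⧺⇒0 (fix-head alt (M zero)) (tail M) E eq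

  -- By linearity each added term is a value of `f` in which a row of `E` occurs twice.
  add-later-multiples : ∀ {n m k} {f : Form (n ℕ.+ m) k} → Alternating f →
    ∀ (M N : Vector (Row k) n) (E : Vector (Row k) m) (c : Fin n → Fin m → Carrier) →
    (∀ i t → M i t ≈ N i t + sum (λ s → c i s * E s t)) → f (M ⧺ E) ≈ f (N ⧺ E)
  add-later-multiples {zero} alt M N E c eq = refl
  add-later-multiples {suc n} {f = f} alt M N E c eq = begin
    f (M zero ∷ (tail M ⧺ E))
      ≈⟨ cong (eq zero) ⟩
    f ((λ t → N zero t + sum (λ s → c zero s * E s t)) ∷ (tail M ⧺ E))
      ≈⟨ +-homo (N zero) (λ t → sum (λ s → c zero s * E s t)) ⟩
    f (N zero ∷ (tail M ⧺ E)) + f ((λ t → sum (λ s → c zero s * E s t)) ∷ (tail M ⧺ E))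
      ≈⟨ +-congˡ (trans (sum-homo (c zero) E) (sum-zero λ s → trans (*-congˡ {c zero s} (E-repeated s)) (zeroʳ _))) ⟩
    f (N zero ∷ (tail M ⧺ E)) + 0#
      ≈⟨ +-identityʳ _ ⟩
    f (N zero ∷ (tail M ⧺ E))
      ≈⟨ add-later-multiples (fix-head alt (N zero)) (tail M) (tail N) E (tail c) (λ i → eq (suc i)) ⟩
    f (N zero ∷ (tail N ⧺ E)) ∎
    where
    open Linear (linear alt (tail M ⧺ E))
    E-repeated : ∀ s → f (E s ∷ (tail M ⧺ E)) ≈ 0#
    E-repeated s = repeated⇒0 alt {E s} {tail M ⧺ E} (n ↑ʳ s) λ t →
      reflexive (≡.cong-app (≡.sym (⧺-↑ʳ (tail M) E s)) t)

  pad : ∀ {n} m → Row n → Row (n ℕ.+ m)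
  pad m w = w ⧺ λ (_ : Fin m) → 0#

  Linear-pad : ∀ {n} m → LinearMap {n} (pad m)
  Linear-pad {zero}  m t       = Linear-0
  Linear-pad {suc n} m zero    = Linear-entry zero
  Linear-pad {suc n} m (suc t) = Linear-∘ {T = tail} (λ t → Linear-entry (suc t)) (Linear-pad m t)

  pad-identity : ∀ {n} m (i : Fin n) t → pad m (identity i) t ≈ δ (toℕ i) (toℕ t)
  pad-identity m zero    zero    = refl
  pad-identity {suc n} m zero    (suc t) = pad-0 {n} t
    where
    pad-0 : ∀ {n} (t : Fin (n ℕ.+ m)) → pad {n} m (λ _ → 0#) t ≈ 0#
    pad-0 {zero}  t       = refl
    pad-0 {suc n} zero    = refl
    pad-0 {suc n} (suc t) = pad-0 {n} t
  pad-identity m (suc i) zero    = refl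
  pad-identity m (suc i) (suc t) = pad-identity m i t

  split-row : ∀ n {m} (v : Row (n ℕ.+ m)) t →
    v t ≈ pad m (λ (j : Fin n) → v (j ↑ˡ m)) t + sum (λ (s : Fin m) → v (n ↑ʳ s) * δ (n ℕ.+ toℕ s) (toℕ t))
  split-row zero    v t       = sym (trans (+-identityˡ _) (sum-δ v t))
  split-row (suc n) {m} v zero    = sym (trans (+-congˡ (sum-zero {m} λ s → zeroʳ _)) (+-identityʳ _))
  split-row (suc n) v (suc t) = split-row n (tail v) t

  -- For fixed `E` the left side is an alternating form in the square matrix `W`, so
  -- `alternating-unique` extracts `det W`. Nothing is demanded of `E`.
  block-triangular : ∀ {n m} {f : Form (n ℕ.+ m) (n ℕ.+ m)} → Alternating f → ∀ W (E : Vector (Row (n ℕ.+ m)) m) →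
    f ((λ i → pad m (W i)) ⧺ E) ≈ det W * f ((λ (i : Fin n) → pad m (identity i)) ⧺ E)
  block-triangular {m = m} alt W E = alternating-unique (pullback (Linear-pad m) (fix-last alt E)) W

  -- The unit rows clear the last `m` columns of `V`, and `block-triangular` then extracts the
  -- minor. Used twice: for the matrix of the p(m+i, j), and for the leading coefficient of
  -- `orthPoly`.
  leading-minor : ∀ n {m} {f : Form (n ℕ.+ m) (n ℕ.+ m)} → Alternating f → ∀ V →
    f (V ⧺ λ (s : Fin m) t → δ (n ℕ.+ toℕ s) (toℕ t)) ≈ det (λ (i j : Fin n) → V i (j ↑ˡ m)) * f identity
  leading-minor n {m} {f} alt V = begin
    f (V ⧺ E)
      ≈⟨ add-later-multiples alt V (λ i → pad m (W i)) E (λ i s → V i (n ↑ʳ s)) (λ i → split-row n (V i)) ⟩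
    f ((λ i → pad m (W i)) ⧺ E)
      ≈⟨ block-triangular alt W E ⟩
    det W * f ((λ (i : Fin n) → pad m (identity i)) ⧺ E)
      ≈⟨ *-congˡ (congruent alt λ i t → trans
           (⧺-cong {E = E} (λ r → pad-identity m r) ≐-refl i t)
           (reflexive (≡.cong-app (⧺-toℕ n (λ r (t : Fin (n ℕ.+ m)) → δ r (toℕ t)) i) t))) ⟩
    det W * f identity ∎
    where
    W : Vector (Row n) n
    W i j = V i (j ↑ˡ m)
    E : Vector (Row (n ℕ.+ m)) m
    E s t = δ (n ℕ.+ toℕ s) (toℕ t)

  -- Peeling off unitriangular rows.

  -- `punchIn` freed of its bound, to renumber the columns of rows defined on all of ℕ.
  skip : ℕ → ℕ → ℕ
  skip zero    s       = suc s
  skip (suc j) zero    = zero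
  skip (suc j) (suc s) = suc (skip j s)

  toℕ-punchIn : ∀ {n} (j : Fin (suc n)) s → toℕ (punchIn j s) ≡ skip (toℕ j) (toℕ s)
  toℕ-punchIn zero    s       = ≡.refl
  toℕ-punchIn (suc j) zero    = ≡.refl
  toℕ-punchIn (suc j) (suc s) = ≡.cong suc (toℕ-punchIn j s)

  skip-< : ∀ {j s} → s ℕ.< j → skip j s ≡ s
  skip-< {suc j} {zero}  s<j       = ≡.refl
  skip-< {suc j} {suc s} (s≤s s<j) = ≡.cong suc (skip-< s<j)

  skip-≥ : ∀ {j s} → j ℕ.≤ s → skip j s ≡ suc s
  skip-≥ {zero}          j≤s       = ≡.refl
  skip-≥ {suc j} {suc s} (s≤s j≤s) = ≡.cong suc (skip-≥ j≤s)

  -- The first row of `A` is the unit vector at column `m`, so the expansion has one term, with sign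
  -- `ε ^ m`. Deleting column `m` shifts the leading 1 of the next row from `m + 1` to `m`, which
  -- restores the hypotheses; hence the same sign occurs `n` times. The columns below `m`, all that
  -- remains of `B` at the end, are never renumbered.
  det-unitriangular-⧺ : ∀ n {m} (A : Fin n → ℕ → Carrier) (B : Fin m → ℕ → Carrier) →
    (∀ i j → j ℕ.< m → A i j ≈ 0#) →
    (∀ i → A i (m ℕ.+ toℕ i) ≈ 1#) →
    (∀ i j → m ℕ.+ toℕ i ℕ.< j → A i j ≈ 0#) →
    det ((λ i (j : Fin (n ℕ.+ m)) → A i (toℕ j)) ⧺ (λ i j → B i (toℕ j)))
      ≈ (ε ^ m) ^ n * det (λ i j → B i (toℕ j))
  det-unitriangular-⧺ zero A B _ _ _ = sym (*-identityˡ _)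
  det-unitriangular-⧺ (suc n) {m} A B below diag above = begin
    sum (λ j → ε ^ toℕ j * (A zero (toℕ j) * det (minor j)))
      ≈⟨ sum-cong (λ j → trans (*-congˡ (*-congʳ (A₀≈δ j)))
           (solve 3 (λ e d x → e :* (d :* x) := (e :* x) :* d) refl (ε ^ toℕ j) (δ (toℕ j) (toℕ j₀)) (det (minor j)))) ⟩
    sum (λ j → ε ^ toℕ j * det (minor j) * δ (toℕ j) (toℕ j₀))
      ≈⟨ sum-δ (λ j → ε ^ toℕ j * det (minor j)) j₀ ⟩
    ε ^ toℕ j₀ * det (minor j₀)
      ≈⟨ *-cong (^-congʳ ε toℕ-j₀) (det-cong minor-rows) ⟩
    ε ^ m * det ((λ i (j : Fin (n ℕ.+ m)) → A (suc i) (skip m (toℕ j))) ⧺ (λ i j → B i (skip m (toℕ j))))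
      ≈⟨ *-congˡ (det-unitriangular-⧺ n (λ i j → A (suc i) (skip m j)) (λ i j → B i (skip m j))
           (λ i j j<m → trans (reflexive (≡.cong (A (suc i)) (skip-< j<m))) (below (suc i) j j<m))
           (λ i → trans (reflexive (≡.cong (A (suc i))
              (≡.trans (skip-≥ (m≤m+n m (toℕ i))) (≡.sym (+-suc m (toℕ i)))))) (diag (suc i)))
           (λ i j m+i<j → trans
              (reflexive (≡.cong (A (suc i)) (skip-≥ (≤-trans (m≤m+n m (toℕ i)) (<⇒≤ m+i<j)))))
              (above (suc i) (suc j) (≡.subst (ℕ._< suc j) (≡.sym (+-suc m (toℕ i))) (s≤s m+i<j))))) ⟩
    ε ^ m * ((ε ^ m) ^ n * det (λ i j → B i (skip m (toℕ j))))
      ≈⟨ *-assoc _ _ _ ⟨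
    (ε ^ m) ^ suc n * det (λ i j → B i (skip m (toℕ j)))
      ≈⟨ *-congˡ (det-cong λ i j → reflexive (≡.cong (B i) (skip-< (toℕ<n j)))) ⟩
    (ε ^ m) ^ suc n * det (λ i j → B i (toℕ j)) ∎
    where
    j₀ : Fin (suc n ℕ.+ m)
    j₀ = fromℕ< (s≤s (m≤n+m m n))
    toℕ-j₀ : toℕ j₀ ≡ m
    toℕ-j₀ = toℕ-fromℕ< _
    minor : Fin (suc n ℕ.+ m) → Vector (Row (n ℕ.+ m)) (n ℕ.+ m)
    minor j r s = ((λ i (j : Fin (suc n ℕ.+ m)) → A (suc i) (toℕ j)) ⧺ (λ i j → B i (toℕ j))) r (punchIn j s)
    A₀≈δ : ∀ j → A zero (toℕ j) ≈ δ (toℕ j) (toℕ j₀)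
    A₀≈δ j rewrite toℕ-j₀ with <-cmp (toℕ j) m
    ... | tri< j<m _ _ = trans (below zero _ j<m) (reflexive (≡.sym (δ-< j<m)))
    ... | tri≈ _ eq _ rewrite eq = trans
      (trans (reflexive (≡.cong (A zero) (≡.sym (+-identityʳ-ℕ m)))) (diag zero))
      (reflexive (≡.sym (δ-diag m)))
    ... | tri> _ _ j>m = trans
      (above zero _ (≡.subst (ℕ._< toℕ j) (≡.sym (+-identityʳ-ℕ m)) j>m)) (reflexive (≡.sym (δ-> j>m)))
    punchIn-j₀ : ∀ (s : Fin (n ℕ.+ m)) → toℕ (punchIn j₀ s) ≡ skip m (toℕ s)
    punchIn-j₀ s = ≡.trans (toℕ-punchIn j₀ s) (≡.cong (λ m → skip m (toℕ s)) toℕ-j₀)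
    minor-rows : minor j₀ ≐ ((λ i (j : Fin (n ℕ.+ m)) → A (suc i) (skip m (toℕ j))) ⧺ (λ i j → B i (skip m (toℕ j))))
    minor-rows r s = trans
      (reflexive (≡.cong-app (⧺-map (λ w s → w (punchIn j₀ s))
        (λ i (j : Fin (suc n ℕ.+ m)) → A (suc i) (toℕ j)) (λ i j → B i (toℕ j)) r) s))
      (⧺-cong (λ i s → reflexive (≡.cong (A (suc i)) (punchIn-j₀ s)))
        (λ i s → reflexive (≡.cong (B i) (punchIn-j₀ s))) r s)

  det-cong-size : ∀ {n n′} → n ≡ n′ → (A : ℕ → ℕ → Carrier) →
    det {n} (λ i j → A (toℕ i) (toℕ j)) ≈ det {n′} (λ i j → A (toℕ i) (toℕ j))
  det-cong-size ≡.refl A = refl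

  -- The case `m = 0` of peeling: every sign is `ε ^ 0` and the block left over is empty.
  det-lower-unitriangular : ∀ n (A : ℕ → ℕ → Carrier) →
    (∀ i → A i i ≈ 1#) → (∀ i j → i ℕ.< j → A i j ≈ 0#) →
    det {n} (λ i j → A (toℕ i) (toℕ j)) ≈ 1#
  det-lower-unitriangular n A diag above = begin
    det {n} (λ i j → A (toℕ i) (toℕ j))
      ≈⟨ det-cong-size (≡.sym (+-identityʳ-ℕ n)) A ⟩
    det {n ℕ.+ 0} (λ i j → A (toℕ i) (toℕ j))
      ≈⟨ det-cong (λ i j → reflexive (≡.cong-app (⧺-toℕ n {0} (λ r (j : Fin (n ℕ.+ 0)) → A r (toℕ j)) i) j)) ⟨
    det ((λ (i : Fin n) (j : Fin (n ℕ.+ 0)) → A (toℕ i) (toℕ j)) ⧺ (λ (i : Fin 0) j → A (n ℕ.+ toℕ i) (toℕ j)))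
      ≈⟨ det-unitriangular-⧺ n (λ i → A (toℕ i)) (λ i → A (n ℕ.+ toℕ i)) (λ _ _ ()) (λ i → diag (toℕ i)) (λ i → above (toℕ i)) ⟩
    1# ^ n * 1#
      ≈⟨ trans (*-identityʳ _) (1^n≈1 n) ⟩
    1# ∎
    where
    1^n≈1 : ∀ n → 1# ^ n ≈ 1#
    1^n≈1 zero    = refl
    1^n≈1 (suc n) = trans (*-identityˡ _) (1^n≈1 n)

  det-identity : ∀ n → det (identity {n}) ≈ 1#
  det-identity n = det-lower-unitriangular n δ (λ i → reflexive (δ-diag i)) (λ i j i<j → reflexive (δ-< i<j))

  -- Row scaling and products of signs.

  scale-rows : ∀ {n k} {f : Form n k} → Alternating f → ∀ c M →
               f (λ i t → c i * M i t) ≈ product c * f M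
  scale-rows {zero} alt c M = trans (congruent alt λ ()) (sym (*-identityˡ _))
  scale-rows {suc n} {f = f} alt c M = begin
    f (λ i t → c i * M i t)
      ≈⟨ congruent alt (∷-η _) ⟩
    f ((λ t → c zero * M zero t) ∷ λ i t → c (suc i) * M (suc i) t)
      ≈⟨ Linear.*-homo (linear alt _) (c zero) (M zero) ⟩
    c zero * f (M zero ∷ λ i t → c (suc i) * M (suc i) t)
      ≈⟨ *-congˡ (scale-rows (fix-head alt (M zero)) (tail c) (tail M)) ⟩
    c zero * (product (tail c) * f (M zero ∷ tail M))
      ≈⟨ *-assoc _ _ _ ⟨
    product c * f (M zero ∷ tail M)
      ≈⟨ *-congˡ (congruent alt (∷-η M)) ⟨
    product c * f M ∎

  product-involutive : ∀ {n} (c : Vector Carrier n) → (∀ i → c i * c i ≈ 1#) → product c * product c ≈ 1#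
  product-involutive {zero}  c eq = *-identityˡ 1#
  product-involutive {suc n} c eq = trans
    (solve 2 (λ a b → (a :* b) :* (a :* b) := (a :* a) :* (b :* b)) refl (c zero) (product (tail c)))
    (trans (*-cong (eq zero) (product-involutive (tail c) (λ i → eq (suc i)))) (*-identityˡ 1#))

  ε^n*ε^n≈1 : ∀ n → ε ^ n * ε ^ n ≈ 1#
  ε^n*ε^n≈1 zero    = *-identityˡ 1#
  ε^n*ε^n≈1 (suc n) = trans
    (solve 2 (λ a b → (a :* b) :* (a :* b) := (a :* a) :* (b :* b)) refl ε (ε ^ n))
    (trans (*-cong ε*ε≈1 (ε^n*ε^n≈1 n)) (*-identityˡ 1#))

  δ-sym : ∀ i j → δ i j ≡ δ j i
  δ-sym zero    zero    = ≡.refl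
  δ-sym zero    (suc j) = ≡.refl
  δ-sym (suc i) zero    = ≡.refl
  δ-sym (suc i) (suc j) = δ-sym i j

  sum-δ-ℕ : ∀ {n j} (g : ℕ → Carrier) → j ℕ.< n → sum (λ (t : Fin n) → g (toℕ t) * δ (toℕ t) j) ≈ g j
  sum-δ-ℕ {n} g j<n = ≡.subst (λ j → sum (λ (t : Fin n) → g (toℕ t) * δ (toℕ t) j) ≈ g j)
    (toℕ-fromℕ< j<n) (sum-δ (λ t → g (toℕ t)) (fromℕ< j<n))

-- Linear functionals on polynomials.

module PolynomialTheory {c ℓ} (R : CommutativeRing c ℓ) where
  open CommutativeRing R hiding (zero)
  open DeterminantTheory R
  open Polynomials rawRing
  open import Data.List.Base using ([]; _∷_; map)
  open import Algebra.Properties.CommutativeSemiring.Exp commutativeSemiring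
  open import Algebra.Properties.Semiring.Sum semiring
  open import Relation.Binary.Reasoning.Setoid setoid
  module R[x] where
    open RawRing polyRawRing public
    open RawSemiringOps rawSemiring public using (_^_; sum)
    open Determinant polyRawRing public using (det)

  coeff-+ : ∀ f g j → coeff (f +ₚ g) j ≈ coeff f j + coeff g j
  coeff-+ []      g       j       = sym (+-identityˡ _)
  coeff-+ (x ∷ f) []      j       = sym (+-identityʳ _)
  coeff-+ (x ∷ f) (y ∷ g) zero    = refl
  coeff-+ (x ∷ f) (y ∷ g) (suc j) = coeff-+ f g j

  coeff-map-* : ∀ a f j → coeff (map (a *_) f) j ≈ a * coeff f j
  coeff-map-* a []      j       = sym (zeroʳ a)
  coeff-map-* a (x ∷ f) zero    = refl
  coeff-map-* a (x ∷ f) (suc j) = coeff-map-* a f j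

  coeff-const-* : ∀ a f j → coeff (const a *ₚ f) j ≈ a * coeff f j
  coeff-const-* a f j = trans (coeff-+ (map (a *_) f) (0# ∷ []) j)
    (trans (+-cong (coeff-map-* a f j) (coeff-0 j)) (+-identityʳ _))
    where
    coeff-0 : ∀ j → coeff (0# ∷ []) j ≈ 0#
    coeff-0 zero    = refl
    coeff-0 (suc j) = refl

  coeff-*-1 : ∀ f j → coeff (f *ₚ const 1#) j ≈ coeff f j
  coeff-*-1 []      j       = refl
  coeff-*-1 (x ∷ f) zero    = trans (+-identityʳ _) (*-identityʳ x)
  coeff-*-1 (x ∷ f) (suc j) = coeff-*-1 f j

  coeff-X* : ∀ f j → coeff (X *ₚ f) (suc j) ≈ coeff f j
  coeff-X* f j = begin
    coeff (X *ₚ f) (suc j)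
      ≈⟨ coeff-+ (map (0# *_) f) (0# ∷ (const 1# *ₚ f)) (suc j) ⟩
    coeff (map (0# *_) f) (suc j) + coeff (const 1# *ₚ f) j
      ≈⟨ +-cong (trans (coeff-map-* 0# f (suc j)) (zeroˡ _)) (trans (coeff-const-* 1# f j) (*-identityˡ _)) ⟩
    0# + coeff f j
      ≈⟨ +-identityˡ _ ⟩
    coeff f j ∎

  coeff-X*-zero : ∀ f → coeff (X *ₚ f) 0 ≈ 0#
  coeff-X*-zero f = trans (coeff-+ (map (0# *_) f) (0# ∷ (const 1# *ₚ f)) 0)
    (trans (+-identityʳ _) (trans (coeff-map-* 0# f 0) (zeroˡ _)))

  coeff-X^ : ∀ n j → coeff (X R[x].^ n) j ≈ δ n j
  coeff-X^ zero    zero    = refl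
  coeff-X^ zero    (suc j) = refl
  coeff-X^ (suc n) zero    = coeff-X*-zero (X R[x].^ n)
  coeff-X^ (suc n) (suc j) = trans (coeff-X* (X R[x].^ n) j) (coeff-X^ n j)

  -- `*-homo` applies to a literal `const`, and multiplication of polynomials is not shown to
  -- respect coefficientwise equality. The power is therefore identified by `≡`; its entry agrees
  -- with `x ^ n` only up to `≈`, since the product of constants adds a zero.
  const-^ : ∀ x n → ∃ λ y → (const x R[x].^ n ≡ const y) × (y ≈ x ^ n)
  const-^ x zero = 1# , ≡.refl , refl
  const-^ x (suc n) with const-^ x n
  ... | y , eq , y≈xⁿ = x * y + 0# , ≡.cong (const x *ₚ_) eq , trans (+-identityʳ _) (*-congˡ y≈xⁿ)

  record LinearFunctional (φ : Poly → Carrier) : Set (c ⊔ ℓ) where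
    field
      cong   : ∀ {f g} → (∀ j → coeff f j ≈ coeff g j) → φ f ≈ φ g
      +-homo : ∀ f g → φ (f +ₚ g) ≈ φ f + φ g
      *-homo : ∀ a f → φ (const a *ₚ f) ≈ a * φ f

    sum-homo : ∀ {n} (F : Fin n → Poly) → φ (R[x].sum F) ≈ sum (λ i → φ (F i))
    sum-homo {zero}  F = trans (cong λ { zero → refl ; (suc j) → refl }) (trans (*-homo 0# []) (zeroˡ _))
    sum-homo {suc n} F = trans (+-homo _ _) (+-congˡ (sum-homo (λ i → F (suc i))))

    sign-homo : ∀ n f → φ ((R[x].- R[x].1#) R[x].^ n *ₚ f) ≈ ε ^ n * φ f
    sign-homo n f with const-^ ε n
    ... | y , eq , y≈εⁿ = trans (reflexive (≡.cong (λ g → φ (g *ₚ f)) eq)) (trans (*-homo y f) (*-congʳ y≈εⁿ))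

    -- Only the last row is not constant, so φ acts on that row alone.
    det-homo : ∀ k (M : Matrix Poly (suc k)) (A : Matrix Carrier (suc k)) →
      (∀ i j → toℕ i ℕ.< k → M i j ≡ const (A i j)) →
      (∀ i j → toℕ i ≡ k → φ (M i j) ≈ A i j) →
      φ (R[x].det M) ≈ det A
    det-homo k M A consts last = trans
      (sum-homo (λ j → (R[x].- R[x].1#) R[x].^ toℕ j *ₚ (M zero j *ₚ R[x].det (minor j))))
      (sum-cong λ j → trans (sign-homo (toℕ j) (M zero j *ₚ R[x].det (minor j)))
        (*-congˡ {ε ^ toℕ j} (head-homo k M A consts last j)))
      where
      minor : Fin (suc k) → Matrix Poly k
      minor j r s = M (suc r) (punchIn j s)
      head-homo : ∀ k (M : Matrix Poly (suc k)) (A : Matrix Carrier (suc k)) →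
        (∀ i j → toℕ i ℕ.< k → M i j ≡ const (A i j)) →
        (∀ i j → toℕ i ≡ k → φ (M i j) ≈ A i j) → ∀ j →
        φ (M zero j *ₚ R[x].det (λ r s → M (suc r) (punchIn j s))) ≈ A zero j * det (λ r s → A (suc r) (punchIn j s))
      -- The top row is now the last one, and its minor is the empty determinant `const 1#`.
      head-homo zero    M A consts last j =
        trans (cong (coeff-*-1 (M zero j))) (trans (last zero j ≡.refl) (sym (*-identityʳ _)))
      head-homo (suc k) M A consts last j rewrite consts zero j (s≤s z≤n) =
        trans (*-homo (A zero j) (R[x].det (λ r s → M (suc r) (punchIn j s))))
          (*-congˡ (det-homo k (λ r s → M (suc r) (punchIn j s)) (λ r s → A (suc r) (punchIn j s))
            (λ i s i<k → consts (suc i) (punchIn j s) (s≤s i<k))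
            (λ i s i≡k → last (suc i) (punchIn j s) (≡.cong suc i≡k))))

  coeff-linear : ∀ t → LinearFunctional λ f → coeff f t
  coeff-linear t = record
    { cong = λ eq → eq t ; +-homo = λ f g → coeff-+ f g t ; *-homo = λ a f → coeff-const-* a f t }

  -- The functional x^t ↦ `ν t`, truncated at degree `N`. It is exact on x^t for `t < N`, and the
  -- finite sum is already the product of a row of coefficients with a column of a matrix of size
  -- `N`.
  moment-linear : ∀ N (ν : ℕ → Carrier) →
    LinearFunctional λ f → sum (λ (t : Fin N) → coeff f (toℕ t) * ν (toℕ t))
  moment-linear N ν = record
    { cong   = λ eq → sum-cong λ (t : Fin N) → *-congʳ {ν (toℕ t)} (eq (toℕ t))
    ; +-homo = λ f g → trans
        (sum-cong λ (t : Fin N) → trans (*-congʳ (coeff-+ f g (toℕ t))) (distribʳ (ν (toℕ t)) _ _))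
        (∑-distrib-+ {N} (λ t → coeff f (toℕ t) * ν (toℕ t)) (λ t → coeff g (toℕ t) * ν (toℕ t)))
    ; *-homo = λ a f → trans
        (sum-cong λ (t : Fin N) → trans (*-congʳ (coeff-const-* a f (toℕ t))) (*-assoc a _ (ν (toℕ t))))
        (sym (*-distribˡ-sum {N} a (λ t → coeff f (toℕ t) * ν (toℕ t))))
    }

<ᵇ-true : ∀ {i k} → i ℕ.< k → (i ℕ.<ᵇ k) ≡ true
<ᵇ-true {zero}  (s≤s i<k) = ≡.refl
<ᵇ-true {suc i} (s≤s i<k) = <ᵇ-true i<k

<ᵇ-false : ∀ {i k} → k ℕ.≤ i → (i ℕ.<ᵇ k) ≡ false
<ᵇ-false {i}     {zero}  z≤n       = ≡.refl
<ᵇ-false {suc i} {suc k} (s≤s k≤i) = <ᵇ-false k≤i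

-- Degree, leading coefficient and orthogonality of the polynomials.

module _ {c ℓ₁ ℓ₂} (K : HeytingField c ℓ₁ ℓ₂) where
  private
    R : CommutativeRing c ℓ₁
    R = HeytingCommutativeRing.commutativeRing (HeytingField.heytingCommutativeRing K)
  open CommutativeRing R hiding (zero; rawRing)
  open HeytingField K using (#⇒invertible)
  open OrthogonalPolynomials K hiding (det)
  open DeterminantTheory R
  open PolynomialTheory R
  open Polynomials rawRing
  open import Algebra.Properties.CommutativeSemiring.Exp commutativeSemiring
  open import Algebra.Properties.Semiring.Sum semiring
  open import Algebra.Properties.Monoid.Sum *-monoid using () renaming (sum-replicate to product-replicate)
  open import Algebra.Properties.Group +-group using (ε⁻¹≈ε)
  open import Algebra.Definitions.RawSemiring (Semiring.rawSemiring semiring) using (product)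
  open import Algebra.Solver.Ring.NaturalCoefficients.Default commutativeSemiring
    using (solve; _:=_; _:*_)
  open import Relation.Binary.Reasoning.Setoid setoid

  inverse-* : ∀ {x} (x#0 : HeytingField._#_ K x 0#) → inverse x#0 * x ≈ 1#
  inverse-* {x} x#0 = trans (*-congˡ (sym (trans (+-congˡ ε⁻¹≈ε) (+-identityʳ x)))) (proj₁ (proj₂ (#⇒invertible x#0)))

  module _ (μ : ℕ → Carrier) (H#0 : NonvanishingHankel μ) where

    -- The scalar shadow of `momentMatrix`: a functional replaces the last row 1, x, ..., x^k by its
    -- values `ν`.
    bordered : ℕ → (ℕ → Carrier) → ℕ → ℕ → Carrier
    bordered k ν i j = if i ℕ.<ᵇ k then μ (i ℕ.+ j) else ν j

    det-bordered : ∀ k {ν ν′ : ℕ → Carrier} → (∀ {j} → j ℕ.≤ k → ν j ≈ ν′ j) →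
      det {suc k} (λ i j → bordered k ν (toℕ i) (toℕ j)) ≈
      det ((λ (i : Fin k) (j : Fin (k ℕ.+ 1)) → μ (toℕ i ℕ.+ toℕ j)) ⧺ (λ (_ : Fin 1) j → ν′ (toℕ j)))
    det-bordered k {ν} {ν′} ν≈ν′ = begin
      det {suc k} (λ i j → bordered k ν (toℕ i) (toℕ j))
        ≈⟨ det-cong-size (+-comm-ℕ 1 k) (bordered k ν) ⟩
      det {k ℕ.+ 1} (λ i j → bordered k ν (toℕ i) (toℕ j))
        ≈⟨ det-cong (λ i j → trans
             (reflexive (≡.cong-app (≡.sym (⧺-toℕ k (λ r (j : Fin (k ℕ.+ 1)) → bordered k ν r (toℕ j)) i)) j))
             (⧺-cong {k} (λ r j → reflexive (≡.cong (if_then μ (toℕ r ℕ.+ toℕ j) else ν (toℕ j)) (<ᵇ-true (toℕ<n r))))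
               (λ s j → trans (reflexive (≡.cong (if_then μ (k ℕ.+ toℕ s ℕ.+ toℕ j) else ν (toℕ j)) (<ᵇ-false (m≤m+n k (toℕ s)))))
                  (ν≈ν′ (≤-pred (≤-trans (toℕ<n j) (≤-reflexive (+-comm-ℕ k 1)))))) i j)) ⟩
      det ((λ (i : Fin k) (j : Fin (k ℕ.+ 1)) → μ (toℕ i ℕ.+ toℕ j)) ⧺ (λ (_ : Fin 1) j → ν′ (toℕ j))) ∎

    -- The next three lemmas are instances. The coefficient beyond the degree makes the last row
    -- zero, the coefficient at `k` makes it a unit vector, and the moment functional shifted by
    -- `r < k` makes it a copy of row `r`.
    functional-orthPoly : ∀ {φ} → LinearFunctional φ → ∀ k {ν : ℕ → Carrier} →
      (∀ {j} → j ℕ.≤ k → φ (X R[x].^ j) ≈ ν j) →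
      φ (orthPoly μ H#0 k) ≈ inverse (H#0 k) *
        det ((λ (i : Fin k) (j : Fin (k ℕ.+ 1)) → μ (toℕ i ℕ.+ toℕ j)) ⧺ (λ (_ : Fin 1) j → ν (toℕ j)))
    functional-orthPoly {φ} lin k {ν} eq = begin
      φ (orthPoly μ H#0 k)
        ≈⟨ *-homo (inverse (H#0 k)) (R[x].det (momentMatrix μ k)) ⟩
      inverse (H#0 k) * φ (R[x].det (momentMatrix μ k))
        ≈⟨ *-congˡ (det-homo k (momentMatrix μ k) (λ i j → bordered k (λ j → φ (X R[x].^ j)) (toℕ i) (toℕ j))
             (λ i j i<k → rows-const i j (<ᵇ-true i<k)) (λ i j i≡k → row-last i j (<ᵇ-false (≤-reflexive (≡.sym i≡k))))) ⟩
      inverse (H#0 k) * det {suc k} (λ i j → bordered k (λ j → φ (X R[x].^ j)) (toℕ i) (toℕ j))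
        ≈⟨ *-congˡ (det-bordered k {λ j → φ (X R[x].^ j)} {ν} eq) ⟩
      _ ∎
      where
      open LinearFunctional lin
      rows-const : ∀ i j → (toℕ i ℕ.<ᵇ k) ≡ true →
        momentMatrix μ k i j ≡ const (bordered k (λ j → φ (X R[x].^ j)) (toℕ i) (toℕ j))
      rows-const i j eq rewrite eq = ≡.refl
      row-last : ∀ i j → (toℕ i ℕ.<ᵇ k) ≡ false →
        φ (momentMatrix μ k i j) ≈ bordered k (λ j → φ (X R[x].^ j)) (toℕ i) (toℕ j)
      row-last i j eq rewrite eq = refl

    orthPoly-degree : ∀ k {t} → k ℕ.< t → coeff (orthPoly μ H#0 k) t ≈ 0#
    orthPoly-degree k {t} k<t = trans
      (functional-orthPoly (coeff-linear t) k {λ _ → 0#}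
        (λ {j} j≤k → trans (coeff-X^ j t) (reflexive (δ-< (≤-<-trans j≤k k<t)))))
      (trans (*-congˡ (zero-row-⧺⇒0 {n = k} det-alternating _ _ (λ _ → refl))) (zeroʳ _))

    orthPoly-monic : ∀ k → coeff (orthPoly μ H#0 k) k ≈ 1#
    orthPoly-monic k = begin
      coeff (orthPoly μ H#0 k) k
        -- `k + 0` anticipates the unit row of `leading-minor`, whose index is `k + toℕ s` with `s`
        -- in `Fin 1`.
        ≈⟨ functional-orthPoly (coeff-linear k) k {λ j → δ (k ℕ.+ 0) j}
             (λ {j} _ → trans (coeff-X^ j k) (reflexive
               (≡.trans (δ-sym j k) (≡.cong (λ k → δ k j) (≡.sym (+-identityʳ-ℕ k)))))) ⟩
      inverse (H#0 k) * det (hankel ⧺ (λ (_ : Fin 1) j → δ (k ℕ.+ 0) (toℕ j)))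
        ≈⟨ *-congˡ (det-cong (⧺-cong {M = hankel} ≐-refl (λ { zero j → refl }))) ⟩
      inverse (H#0 k) * det (hankel ⧺ (λ (s : Fin 1) j → δ (k ℕ.+ toℕ s) (toℕ j)))
        ≈⟨ *-congˡ (leading-minor k det-alternating hankel) ⟩
      inverse (H#0 k) * (det (λ i (j : Fin k) → hankel i (j ↑ˡ 1)) * det (identity {k ℕ.+ 1}))
        ≈⟨ *-congˡ (trans (*-cong
             (det-cong {k} λ i j → reflexive (≡.cong (λ t → μ (toℕ i ℕ.+ t)) (toℕ-↑ˡ j 1)))
             (det-identity (k ℕ.+ 1))) (*-identityʳ _)) ⟩
      inverse (H#0 k) * H μ k
        ≈⟨ inverse-* (H#0 k) ⟩
      1# ∎
      where
      hankel : Vector (Row (k ℕ.+ 1)) k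
      hankel i j = μ (toℕ i ℕ.+ toℕ j)

    orthogonality : ∀ {r k N} → r ℕ.< k → k ℕ.< N →
      sum (λ (t : Fin N) → coeff (orthPoly μ H#0 k) (toℕ t) * μ (toℕ t ℕ.+ r)) ≈ 0#
    orthogonality {r} {k} {N} r<k k<N = trans
      (functional-orthPoly (moment-linear N (λ t → μ (t ℕ.+ r))) k {λ j → μ (j ℕ.+ r)} λ {j} j≤k → trans
        (sum-cong {N} λ t → trans (*-congʳ (trans (coeff-X^ j (toℕ t)) (reflexive (δ-sym j (toℕ t))))) (*-comm _ _))
        (sum-δ-ℕ (λ t → μ (t ℕ.+ r)) (≤-<-trans j≤k k<N)))
      (trans (*-congˡ (repeated-⧺⇒0 det-alternating
          (λ i j → μ (toℕ i ℕ.+ toℕ j)) (λ _ j → μ (toℕ j ℕ.+ r)) (fromℕ< r<k) zero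
          λ j → reflexive (≡.cong μ (≡.trans (≡.cong (ℕ._+ toℕ j) (toℕ-fromℕ< r<k)) (+-comm-ℕ r (toℕ j))))))
        (zeroʳ _))

    -- The signed coefficients.

    -- Since `ε ^ t` is its own inverse, the truncated exponent `k ∸ t` can be split into separate
    -- signs for `t` and `k`. This form also covers `t > k`, where the coefficient vanishes by
    -- degree; the factor `ε ^ t` is the one that `Q` absorbs.
    p-coeff : ∀ k t → p μ H#0 k t ≈ ε ^ t * (ε ^ k * coeff (orthPoly μ H#0 k) t)
    p-coeff k t with t ℕ.≤ᵇ k in eq
    ... | true  = begin
      ε ^ (k ℕ.∸ t) * a                        ≈⟨ *-identityˡ _ ⟨
      1# * (ε ^ (k ℕ.∸ t) * a)                 ≈⟨ *-congʳ (ε^n*ε^n≈1 t) ⟨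
      ε ^ t * ε ^ t * (ε ^ (k ℕ.∸ t) * a)
        ≈⟨ solve 3 (λ x y a → (x :* x) :* (y :* a) := x :* ((x :* y) :* a)) refl (ε ^ t) (ε ^ (k ℕ.∸ t)) a ⟩
      ε ^ t * (ε ^ t * ε ^ (k ℕ.∸ t) * a)      ≈⟨ *-congˡ (*-congʳ (^-homo-* ε t (k ℕ.∸ t))) ⟨
      ε ^ t * (ε ^ (t ℕ.+ (k ℕ.∸ t)) * a)      ≈⟨ *-congˡ (*-congʳ (^-congʳ ε (m+[n∸m]≡n
                                                    (≤ᵇ⇒≤ t k (≡.subst T (≡.sym eq) tt))))) ⟩
      ε ^ t * (ε ^ k * a)                      ∎
      where
      a : Carrier
      a = coeff (orthPoly μ H#0 k) t
    ... | false = sym (trans (*-congˡ (trans (*-congˡ (orthPoly-degree k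
      (≰⇒> λ t≤k → ≡.subst T eq (≤⇒≤ᵇ t≤k)))) (zeroʳ _))) (zeroʳ _))

    p-above : ∀ k {t} → k ℕ.< t → p μ H#0 k t ≈ 0#
    p-above k {t} k<t = trans (p-coeff k t)
      (trans (*-congˡ (trans (*-congˡ (orthPoly-degree k k<t)) (zeroʳ _))) (zeroʳ _))

    p-diag : ∀ k → p μ H#0 k k ≈ 1#
    p-diag k = trans (p-coeff k k)
      (trans (*-congˡ (trans (*-congˡ (orthPoly-monic k)) (*-identityʳ _))) (ε^n*ε^n≈1 k))

    p-orthogonal : ∀ {r k N} → r ℕ.< k → k ℕ.< N →
      sum (λ (t : Fin N) → p μ H#0 k (toℕ t) * (ε ^ toℕ t * μ (toℕ t ℕ.+ r))) ≈ 0#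
    p-orthogonal {r} {k} {N} r<k k<N = begin
      sum (λ (t : Fin N) → p μ H#0 k (toℕ t) * (ε ^ toℕ t * μ (toℕ t ℕ.+ r)))
        ≈⟨ sum-cong {N} (λ t → trans (*-congʳ (p-coeff k (toℕ t))) (trans
             (solve 4 (λ x y a m → (x :* (y :* a)) :* (x :* m) := (x :* x) :* (y :* (a :* m)))
                refl (ε ^ toℕ t) (ε ^ k) (coeff (orthPoly μ H#0 k) (toℕ t)) (μ (toℕ t ℕ.+ r)))
             (trans (*-congʳ (ε^n*ε^n≈1 (toℕ t))) (*-identityˡ _)))) ⟩
      sum (λ (t : Fin N) → ε ^ k * (coeff (orthPoly μ H#0 k) (toℕ t) * μ (toℕ t ℕ.+ r)))
        ≈⟨ *-distribˡ-sum {N} (ε ^ k) (λ t → coeff (orthPoly μ H#0 k) (toℕ t) * μ (toℕ t ℕ.+ r)) ⟨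
      ε ^ k * sum (λ (t : Fin N) → coeff (orthPoly μ H#0 k) (toℕ t) * μ (toℕ t ℕ.+ r))
        ≈⟨ trans (*-congˡ (orthogonality r<k k<N)) (zeroʳ _) ⟩
      0# ∎

    -- Two evaluations of one determinant.

    module _ (m n : ℕ) where

      N : ℕ
      N = n ℕ.+ m

      -- Defined on all of ℕ without reference to `n`, so that it can be read with size `n + m` when
      -- rows are peeled and with size `m + n` when `H μ m` is factored out.
      Q : ℕ → ℕ → Carrier
      Q i j = if j ℕ.<ᵇ m then ε ^ i * μ (i ℕ.+ j) else δ i j

      Q-left : ∀ i {j} → j ℕ.< m → Q i j ≡ ε ^ i * μ (i ℕ.+ j)
      Q-left i {j} j<m = ≡.cong (if_then ε ^ i * μ (i ℕ.+ j) else δ i j) (<ᵇ-true j<m)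

      Q-right : ∀ i {j} → m ℕ.≤ j → Q i j ≡ δ i j
      Q-right i {j} m≤j = ≡.cong (if_then ε ^ i * μ (i ℕ.+ j) else δ i j) (<ᵇ-false m≤j)

      _∙Q : Row N → Row N
      (v ∙Q) j = sum (λ i → v i * Q (toℕ i) (toℕ j))

      ∙Q-linear : LinearMap _∙Q
      ∙Q-linear j = Linear-sum λ i → Linear-*ʳ (Q (toℕ i) (toℕ j)) (Linear-entry i)

      δ∙Q : ∀ {i} → i ℕ.< N → ∀ j → ((λ t → δ i (toℕ t)) ∙Q) j ≈ Q i (toℕ j)
      δ∙Q {i} i<N j = trans
        (sum-cong {N} λ t → trans (*-congʳ (reflexive (δ-sym i (toℕ t)))) (*-comm _ _))
        (sum-δ-ℕ (λ t → Q t (toℕ j)) i<N)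

      det[_∙Q] : Form N N
      det[_∙Q] A = det (λ i → A i ∙Q)

      -- This stands in for the product formula: `leading-minor` applies to the form as it is and
      -- yields the minor times `det[_∙Q] identity`.
      det[∙Q]-alternating : Alternating det[_∙Q]
      det[∙Q]-alternating = pullback ∙Q-linear det-alternating

      det-p : Carrier
      det-p = det (λ (i j : Fin n) → p μ H#0 (toℕ i ℕ.+ m) (toℕ j))

      -- The sign (-1)^(m(m-1)/2), left unevaluated because only its square matters.
      σ : Carrier
      σ = product (λ (i : Fin m) → ε ^ toℕ i)

      pad-toℕ : ∀ {m n} (g : ℕ → Carrier) (t : Fin (m ℕ.+ n)) →
        pad {m} n (λ j → g (toℕ j)) t ≈ (if toℕ t ℕ.<ᵇ m then g (toℕ t) else 0#)
      pad-toℕ {zero}  g t       = refl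
      pad-toℕ {suc m} g zero    = refl
      pad-toℕ {suc m} g (suc t) = pad-toℕ {m} (λ j → g (suc j)) t

      -- In the rows `i < m` the unit-vector columns vanish, so these rows are padded rows of the
      -- signed Hankel matrix. Replacing that block by the identity leaves the lower unitriangular
      -- matrix `L`.
      det-Q : det[_∙Q] identity ≈ σ * H μ m
      det-Q = begin
        det (λ i → identity i ∙Q)
          ≈⟨ det-cong (λ i → δ∙Q (toℕ<n i)) ⟩
        det {n ℕ.+ m} (λ i j → Q (toℕ i) (toℕ j))
          ≈⟨ det-cong-size (+-comm-ℕ n m) Q ⟩
        det {m ℕ.+ n} (λ i j → Q (toℕ i) (toℕ j))
          ≈⟨ det-cong (λ i t → trans
               (reflexive (≡.cong-app (≡.sym (⧺-toℕ m (λ r (t : Fin (m ℕ.+ n)) → Q r (toℕ t)) i)) t))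
               (⧺-cong {E = E} top ≐-refl i t)) ⟩
        det ((λ i → pad n (W i)) ⧺ E)
          ≈⟨ block-triangular det-alternating W E ⟩
        det W * det ((λ i → pad n (identity i)) ⧺ E)
          ≈⟨ *-cong (scale-rows (det-alternating {m}) (λ i → ε ^ toℕ i) (λ i j → μ (toℕ i ℕ.+ toℕ j)))
               (trans (det-cong (λ i t → trans
                   (⧺-cong {m} {M = λ i → pad n (identity i)} {λ r t → L (toℕ r) (toℕ t)} {E} {λ s t → L (m ℕ.+ toℕ s) (toℕ t)}
                     (λ r t → trans (pad-identity n r t) (reflexive (≡.sym (L-top (toℕ t) (toℕ<n r)))))
                     (λ s t → reflexive (≡.sym (L-bottom (toℕ t) (m≤m+n m (toℕ s))))) i t)
                   (reflexive (≡.cong-app (⧺-toℕ m (λ r (t : Fin (m ℕ.+ n)) → L r (toℕ t)) i) t))))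
                 (det-lower-unitriangular (m ℕ.+ n) L L-diag L-above)) ⟩
        σ * H μ m * 1#
          ≈⟨ *-identityʳ _ ⟩
        σ * H μ m ∎
        where
        W : Vector (Row m) m
        W i j = ε ^ toℕ i * μ (toℕ i ℕ.+ toℕ j)
        E : Vector (Row (m ℕ.+ n)) n
        E s t = Q (m ℕ.+ toℕ s) (toℕ t)
        top : ∀ (i : Fin m) (t : Fin (m ℕ.+ n)) → Q (toℕ i) (toℕ t) ≈ pad n (W i) t
        top i t = trans (case (<-≤-connex (toℕ t) m)) (sym (pad-toℕ {m} (λ j → ε ^ toℕ i * μ (toℕ i ℕ.+ j)) t))
          where
          case : toℕ t ℕ.< m ⊎ m ℕ.≤ toℕ t → Q (toℕ i) (toℕ t) ≈
            (if toℕ t ℕ.<ᵇ m then ε ^ toℕ i * μ (toℕ i ℕ.+ toℕ t) else 0#)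
          case (inj₁ t<m) rewrite <ᵇ-true t<m = refl
          case (inj₂ m≤t) rewrite <ᵇ-false m≤t = reflexive (δ-< (<-≤-trans (toℕ<n i) m≤t))
        L : ℕ → ℕ → Carrier
        L i j = if i ℕ.<ᵇ m then δ i j else Q i j
        L-top : ∀ {i} j → i ℕ.< m → L i j ≡ δ i j
        L-top {i} j i<m = ≡.cong (if_then δ i j else Q i j) (<ᵇ-true i<m)
        L-bottom : ∀ {i} j → m ℕ.≤ i → L i j ≡ Q i j
        L-bottom {i} j m≤i = ≡.cong (if_then δ i j else Q i j) (<ᵇ-false m≤i)
        L-upper : ∀ {i j} → i ℕ.≤ j → L i j ≡ δ i j
        L-upper {i} {j} i≤j with <-≤-connex i m
        ... | inj₁ i<m = L-top j i<m
        ... | inj₂ m≤i = ≡.trans (L-bottom j m≤i) (Q-right i (≤-trans m≤i i≤j))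
        L-diag : ∀ i → L i i ≈ 1#
        L-diag i = reflexive (≡.trans (L-upper (≤-refl {i})) (δ-diag i))
        L-above : ∀ i j → i ℕ.< j → L i j ≈ 0#
        L-above i j i<j = reflexive (≡.trans (L-upper (<⇒≤ i<j)) (δ-< i<j))

      V : Vector (Row N) n
      V i t = p μ H#0 (toℕ i ℕ.+ m) (toℕ t)

      E : Vector (Row N) m
      E s t = δ (n ℕ.+ toℕ s) (toℕ t)

      det-μ+n : Carrier
      det-μ+n = det (λ (i j : Fin m) → μ (toℕ i ℕ.+ toℕ j ℕ.+ n))

      det[V⧺E∙Q]-by-minor : det[_∙Q] (V ⧺ E) ≈ det-p * (σ * H μ m)
      det[V⧺E∙Q]-by-minor = trans (leading-minor n det[∙Q]-alternating V) (*-cong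
        (det-cong {n} λ i j → reflexive (≡.cong (p μ H#0 (toℕ i ℕ.+ m)) (toℕ-↑ˡ j m))) det-Q)

      det[V⧺E∙Q]-by-orthogonality : det[_∙Q] (V ⧺ E) ≈ σ * det-μ+n
      det[V⧺E∙Q]-by-orthogonality = begin
        det (λ i → (V ⧺ E) i ∙Q)
          ≈⟨ det-cong (λ i j → trans
               (reflexive (≡.cong-app (⧺-map _∙Q V E i) j))
               (⧺-cong {M = λ r → V r ∙Q} {λ r j → A r (toℕ j)} ≐-refl (λ s j → δ∙Q (+-monoʳ-< n (toℕ<n s)) j) i j)) ⟩
        det ((λ i j → A i (toℕ j)) ⧺ (λ s j → Q (n ℕ.+ toℕ s) (toℕ j)))
          ≈⟨ det-unitriangular-⧺ n A (λ s → Q (n ℕ.+ toℕ s)) A-below A-diag A-above ⟩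
        (ε ^ m) ^ n * det (λ (s j : Fin m) → Q (n ℕ.+ toℕ s) (toℕ j))
          ≈⟨ *-congˡ (det-cong λ s j → trans (reflexive (Q-left (n ℕ.+ toℕ s) (toℕ<n j))) (trans
               (*-cong (^-homo-* ε n (toℕ s)) (reflexive (≡.cong μ (shift (toℕ s) (toℕ j))))) (*-assoc _ _ _))) ⟩
        (ε ^ m) ^ n * det (λ (s j : Fin m) → ε ^ n * (ε ^ toℕ s * μ (toℕ s ℕ.+ toℕ j ℕ.+ n)))
          ≈⟨ *-congˡ (trans (scale-rows (det-alternating {m}) (λ _ → ε ^ n) _)
               (*-cong (product-replicate m) (scale-rows (det-alternating {m}) (λ s → ε ^ toℕ s) _))) ⟩
        (ε ^ m) ^ n * ((ε ^ n) ^ m * (σ * det-μ+n))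
          ≈⟨ *-assoc _ _ _ ⟨
        (ε ^ m) ^ n * (ε ^ n) ^ m * (σ * det-μ+n)
          -- Each of the `n` peeled rows gave `ε ^ m`, and each of the `m` remaining rows gave
          -- `ε ^ n` because its index starts at `n`. Both totals equal (-1)^(mn).
          ≈⟨ *-congʳ (trans
               (*-cong (^-assocʳ ε m n) (trans (^-assocʳ ε n m) (^-congʳ ε (*-comm-ℕ n m))))
               (ε^n*ε^n≈1 (m ℕ.* n))) ⟩
        1# * (σ * det-μ+n)
          ≈⟨ *-identityˡ _ ⟩
        σ * det-μ+n ∎
        where
        A : Fin n → ℕ → Carrier
        A i j = sum (λ (t : Fin N) → p μ H#0 (toℕ i ℕ.+ m) (toℕ t) * Q (toℕ t) j)
        shift : ∀ s j → n ℕ.+ s ℕ.+ j ≡ s ℕ.+ j ℕ.+ n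
        shift s j = ≡.trans (+-assoc-ℕ n s j) (+-comm-ℕ n (s ℕ.+ j))
        -- Orthogonality of degree `k = i + m` against the moment shift `j < m ≤ k`; the sum over
        -- `Fin N` reaches far enough because `i < n` gives `k < N`.
        A-below : ∀ i j → j ℕ.< m → A i j ≈ 0#
        A-below i j j<m = trans
          (sum-cong {N} λ t → *-congˡ {p μ H#0 (toℕ i ℕ.+ m) (toℕ t)} (reflexive (Q-left (toℕ t) j<m)))
          (p-orthogonal (<-≤-trans j<m (m≤n+m m (toℕ i))) (+-monoˡ-< m (toℕ<n i)))
        A-right : ∀ i j → m ℕ.≤ j → A i j ≈ sum (λ (t : Fin N) → p μ H#0 (toℕ i ℕ.+ m) (toℕ t) * δ (toℕ t) j)
        A-right i j m≤j = sum-cong {N} λ t →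
          *-congˡ {p μ H#0 (toℕ i ℕ.+ m) (toℕ t)} (reflexive (Q-right (toℕ t) m≤j))
        A-diag : ∀ i → A i (m ℕ.+ toℕ i) ≈ 1#
        A-diag i rewrite +-comm-ℕ m (toℕ i) = trans (A-right i (toℕ i ℕ.+ m) (m≤n+m m (toℕ i)))
          (trans (sum-δ-ℕ (p μ H#0 (toℕ i ℕ.+ m)) (+-monoˡ-< m (toℕ<n i))) (p-diag (toℕ i ℕ.+ m)))
        -- Here `j` may exceed `N`, so the sum cannot be collapsed by `sum-δ-ℕ`. Each term vanishes
        -- by itself: beyond the degree through `p`, up to the degree through `δ`.
        A-above : ∀ i j → m ℕ.+ toℕ i ℕ.< j → A i j ≈ 0#
        A-above i j i<j rewrite +-comm-ℕ m (toℕ i) = trans (A-right i j (≤-trans (m≤n+m m (toℕ i)) (<⇒≤ i<j)))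
          (sum-zero {N} λ t → term t (<-≤-connex (toℕ i ℕ.+ m) (toℕ t)))
          where
          term : ∀ t → toℕ i ℕ.+ m ℕ.< toℕ t ⊎ toℕ t ℕ.≤ toℕ i ℕ.+ m →
            p μ H#0 (toℕ i ℕ.+ m) (toℕ t) * δ (toℕ t) j ≈ 0#
          term t (inj₁ k<t) = trans (*-congʳ (p-above (toℕ i ℕ.+ m) k<t)) (zeroˡ _)
          term t (inj₂ t≤k) = trans (*-congˡ (reflexive (δ-< (≤-<-trans t≤k i<j)))) (zeroʳ _)

      -- Both evaluations carry the factor `σ`, which is removed by multiplying with `σ` once more.
      hankel-shift : H μ m * det-p ≈ det-μ+n
      hankel-shift = begin
        H μ m * det-p                ≈⟨ *-identityˡ _ ⟨
        1# * (H μ m * det-p)         ≈⟨ *-congʳ σ*σ≈1 ⟨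
        σ * σ * (H μ m * det-p)      ≈⟨ solve 3 (λ s h p → (s :* s) :* (h :* p) := s :* (p :* (s :* h)))
                                          refl σ (H μ m) det-p ⟩
        σ * (det-p * (σ * H μ m))    ≈⟨ *-congˡ (trans (sym det[V⧺E∙Q]-by-minor)
                                                   det[V⧺E∙Q]-by-orthogonality) ⟩
        σ * (σ * det-μ+n)            ≈⟨ *-assoc _ _ _ ⟨
        σ * σ * det-μ+n              ≈⟨ trans (*-congʳ σ*σ≈1) (*-identityˡ det-μ+n) ⟩
        det-μ+n                      ∎
        where
        σ*σ≈1 : σ * σ ≈ 1#
        σ*σ≈1 = product-involutive (λ (i : Fin m) → ε ^ toℕ i) (λ i → ε^n*ε^n≈1 (toℕ i))

mainTheorem1 : ∀ {c ℓ₁ ℓ₂} (K : HeytingField c ℓ₁ ℓ₂) →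
  let open HeytingField K
      open OrthogonalPolynomials K
  in (μ : ℕ → Carrier) →
     μ 0 ≈ 1# →
     (H#0 : NonvanishingHankel μ) →
     (m n : ℕ) → 1 ℕ.≤ n →
     det {m} (λ i j → μ (toℕ i ℕ.+ toℕ j)) * det {n} (λ i j → p μ H#0 (toℕ i ℕ.+ m) (toℕ j))
       ≈ det {m} (λ i j → μ (toℕ i ℕ.+ toℕ j ℕ.+ n))
mainTheorem1 K μ _ H#0 m n _ = hankel-shift K μ H#0 m n
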